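{- Let $\star\in\{r,f\}$ and take $\mathtt{Ans}=\mathbb{R}_+\cup\{+\infty\}$ and $X=\Sigma_\star$. For every instruction $P$, the map $\kappa\mapsto\operatorname{wp}\llbracket P\rrbracket_\star(\kappa)$ is an upper $\omega$-continuous parametric prevision (on $\mathcal{M}_+(\Sigma_\star)$).
   Context: $\mathcal{V}$ is a countable set of variables. Expressions: $e ::= a \mid x \mid \dot{ - }e \mid e\,\dot{+}\,e \mid e\,\dot{ - }\,e\mid e\,\dot{\times}\, e\mid e\,\dot{/}\,e$ with $a\in\mathbb{Q}$, $x\in\mathcal{V}$. Tests: $t::= e\,\dot{<=}\,e\mid e\,\dot{<}\,e\mid e\,\dot{==}\,e\mid e\,\dot{!=}\,e\mid\, !t$. Instructions: $P::=\mathrm{skip}\mid x:=e\mid \mathrm{if}\ t\ \mathrm{then}\ P_1\ \mathrm{else}\ P_0\mid\mathrm{while}\ t\ P\mid P;Q$. Values. $\mathbb{F}\subset\mathbb{R}$ is the finite set of floating-point numbers, with smallest element $F_{\min}$ and largest element $F_{\max}$. $\mathbb{R}_e=\mathbb{R}\cup\{\mathbf{err}\}$, $\mathbb{F}_e=\mathbb{F}\cup\{\mathbf{err}\}$, with $\mathbf{err}$ an extra symbol. For $r\in\mathbb{R}_e$ and $\diamond\in\{+,-,\times,/\}$: $\mathbf{err}\diamond r=r\diamond\mathbf{err}=r/0=-\mathbf{err}=\mathbf{err}$. $\mathbf{inj}:\mathbb{F}_e\to\mathbb{R}_e$ is the inclusion. $\mathbf{proj}:\mathbb{R}_e\to\mathbb{F}_e$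 is a fixed Borel measurable map with $\mathbf{proj}(r)=\mathbf{err}$ if $r\notin[F_{\min},F_{\max}]$, and $\mathbf{proj}(\mathbf{inj}(f))=f$ for all $f\in\mathbb{F}_e$. Environments. $\Sigma_r$ is the set of maps $\mathcal{V}\to\mathbb{R}_e$, $\Sigma_f$ the set of maps $\mathcal{V}\to\mathbb{F}_e$. $\mathbb{R}_e$ has the topology whose opens are the open subsets of $\mathbb{R}$, $\{\mathbf{err}\}$, and their unions; $\mathbb{F}_e$ is discrete; $\Sigma_r$, $\Sigma_f$ have the product topology; all carry Borel $\sigma$-algebras. Expression semantics. Real: $\llbracket a\rrbracket_r(\rho)=a$, $\llbracket x\rrbracket_r(\rho)=\rho(x)$, $\llbracket \dot{ - }e\rrbracket_r(\rho)=-\llbracket e\rrbracket_r(\rho)$, $\llbracket e_1\dot{\diamond}e_2\rrbracket_r(\rho)=\llbracket e_1\rrbracket_r(\rho)\diamond\llbracket e_2\rrbracket_r(\rho)$. Floating-point: $\llbracket a\rrbracket_f(\rho)=\mathbf{proj}(a)$, $\llbracket x\rrbracket_f(\rho)=\rho(x)$, $\llbracket \dot{ - }e\rrbracket_f(\rho)=\mathbf{proj}(-\mathbf{inj}(\llbracket e\rrbracket_f(\rho)))$, $\llbracket e_1\dot{\diamond}e_2\rrbracket_f(\rho)=\mathbf{proj}(\mathbf{inj}(\llbracket e_1\rrbracket_f(\rho))\diamond\mathbf{inj}(\llbracket e_2\rrbracket_f(\rho)))$. Test semantics. For $R$ one of $\le,<,=,\ne$ (corresponding to $\dot{<=},\dot{<},\dot{==},\dot{!=}$),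 $\llbracket e_1\dot{R}e_2\rrbracket_\star(\rho)$ is $\{0,1\}$ if $\llbracket e_1\rrbracket_\star(\rho)=\mathbf{err}$ or $\llbracket e_2\rrbracket_\star(\rho)=\mathbf{err}$; otherwise it is $\{1\}$ if $\llbracket e_1\rrbracket_\star(\rho)\,R\,\llbracket e_2\rrbracket_\star(\rho)$ and $\{0\}$ if not. $\llbracket !t\rrbracket_\star(\rho)=\{1-v\mid v\in\llbracket t\rrbracket_\star(\rho)\}$. Instruction semantics. For $\kappa:\Sigma_\star\to\mathtt{Ans}$, $\operatorname{wp}\llbracket P\rrbracket_\star(\kappa):\Sigma_\star\to\mathtt{Ans}$ is defined by recursion on $P$: - $\operatorname{wp}\llbracket\mathrm{skip}\rrbracket_\star(\kappa)=\kappa$; - $\operatorname{wp}\llbracket x:=e\rrbracket_\star(\kappa)(\rho)=\kappa(\rho[x\to\llbracket e\rrbracket_\star(\rho)])$; - $\operatorname{wp}\llbracket P;Q\rrbracket_\star(\kappa)=\operatorname{wp}\llbracket P\rrbracket_\star(\operatorname{wp}\llbracket Q\rrbracket_\star(\kappa))$; - $\operatorname{wp}\llbracket\mathrm{if}\ t\ \mathrm{then}\ P_1\ \mathrm{else}\ P_0\rrbracket_\star(\kappa)(\rho)=\sup_{i\in\llbracket t\rrbracket_\star(\rho)}\operatorname{wp}\llbracket P_i\rrbracket_\star(\kappa)(\rho)$; - $\operatorname{wp}\llbracket\mathrm{while}\ t\ P\rrbracket_\star=\sup_{n\in\mathbb{N}}H_{t,P}^n(\bot)$, where, for $\varphi:(\Sigma_\star\to\mathtt{Ans})\to(\Sigma_\star\to\mathtt{Ans})$,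 $H_{t,P}(\varphi)(\kappa)(\rho)$ equals $\operatorname{wp}\llbracket P\rrbracket_\star(\varphi(\kappa))(\rho)$ if $\llbracket t\rrbracket_\star(\rho)=\{1\}$, equals $\kappa(\rho)$ if $\llbracket t\rrbracket_\star(\rho)=\{0\}$, and equals the supremum of these two values if $\llbracket t\rrbracket_\star(\rho)=\{0,1\}$; $\bot(\kappa)(\rho)$ is the least element of $\mathtt{Ans}$ for all $\kappa,\rho$; suprema are pointwise. Parametric previsions. For a topological space $X$ with its Borel $\sigma$-algebra, $\mathcal{M}_+(X)$ is the set of measurable functions $X\to[0,+\infty]$, ordered pointwise. Arithmetic conventions: $0\times(+\infty)=(+\infty)\times 0=0$, $(+\infty)\times(+\infty)=+\infty$, $x+(+\infty)=(+\infty)+x=+\infty$. A map $F:\mathcal{M}_+(X)\to\mathcal{M}_+(X)$ is a parametric prevision if it is positively homogeneous ($F(\alpha f)=\alpha F(f)$ for real $\alpha\ge0$) and monotonic. It is upper if $F(f+g)\le F(f)+F(g)$ for all $f,g\in\mathcal{M}_+(X)$, and $\omega$-continuous if $F(\sup_n f_n)=\sup_nF(f_n)$ for every ascending sequence $(f_n)_{n\in\mathbb{N}}$ in $\mathcal{M}_+(X)$. The claim includes that $\operatorname{wp}\llbracket P\rrbracket_\star$ maps $\mathcal{M}_+(\Sigma_\star)$ to itself. -}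

module Defs where

open import Algebra.Structures using (IsCommutativeRing)
open import Axiom.ExcludedMiddle using (ExcludedMiddle)
open import Data.Bool.Base using (Bool; true; false; not; if_then_else_)
open import Data.Integer.Base using (ℤ; +_; -[1+_])
open import Data.Irrelevant as Irr using ([_])
open import Data.List.Base using (List)
open import Data.List.Membership.Propositional using (_∈_)
open import Data.Maybe.Base as Maybe using (Maybe; just; nothing)
open import Data.Nat.Base using (ℕ; zero; suc)
open import Data.Nat.GeneralisedArithmetic using (fold)
open import Data.Product.Base using (Σ-syntax; ∃; ∃-syntax; _×_; _,_; proj₁)
open import Data.Rational.Base as ℚ using (ℚ)
open import Data.Refinement.Base using (Refinement-syntax; value; _,_)
open import Data.Sum.Base using (_⊎_; inj₁; inj₂)
open import Data.Unit.Base using (⊤)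
open import Function.Base using (id)
open import Level using (0ℓ; _⊔_) renaming (suc to lsuc)
open import Relation.Binary.PropositionalEquality.Core using (_≡_; _≢_; refl; sym)
open import Relation.Binary.Structures using (IsTotalOrder)
open import Relation.Nullary.Construct.Add.Supremum using (_⁺; ⊤⁺; [_])
open import Relation.Nullary.Decidable.Core using (Dec; yes; no; does; recompute)
open import Relation.Nullary.Negation.Core using (¬_)
open import Relation.Unary using (Pred; U; ∁; ⋃; _≐_; _⊢_; ｛_｝)
import Relation.Binary.Construct.Add.Supremum.NonStrict as Supremum

-- ℝ is axiomatised as a Dedekind-complete ordered field, which
-- determines it up to isomorphism.

record Reals : Set₁ where
  infix  4 _≤_ _<_
  infixl 6 _+_
  infixl 7 _*_
  infix  8 -_
  infix  9 _⁻¹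
  field
    ℝ     : Set
    _+_   : ℝ → ℝ → ℝ
    _*_   : ℝ → ℝ → ℝ
    -_    : ℝ → ℝ
    0#    : ℝ
    1#    : ℝ
    _⁻¹   : ℝ → ℝ          -- 0# ⁻¹ is unspecified
    _≤_   : ℝ → ℝ → Set

    isCommutativeRing : IsCommutativeRing _≡_ _+_ _*_ -_ 0# 1#
    0≢1               : 0# ≢ 1#
    ⁻¹-inverseʳ       : ∀ {x} → x ≢ 0# → x * x ⁻¹ ≡ 1#

    isTotalOrder      : IsTotalOrder _≡_ _≤_
    +-monoˡ-≤         : ∀ {x y} z → x ≤ y → x + z ≤ y + z
    *-nonNegative     : ∀ {x y} → 0# ≤ x → 0# ≤ y → 0# ≤ x * y

  UpperBound : Pred ℝ 0ℓ → ℝ → Set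
  UpperBound S b = ∀ {x} → S x → x ≤ b

  field
    complete : (S : Pred ℝ 0ℓ) → ∃ S → ∃ (UpperBound S) →
               ∃[ s ] UpperBound S s × (∀ {b} → UpperBound S b → s ≤ b)

  _<_ : ℝ → ℝ → Set
  x < y = x ≤ y × x ≢ y

  fromℕ : ℕ → ℝ
  fromℕ zero    = 0#
  fromℕ (suc n) = 1# + fromℕ n

  fromℤ : ℤ → ℝ
  fromℤ (+ n)    = fromℕ n
  fromℤ -[1+ n ] = - fromℕ (suc n)

  fromℚ : ℚ → ℝ
  fromℚ q = fromℤ (ℚ.↥ q) * (fromℤ (ℚ.↧ q)) ⁻¹

-- Only the family of open sets is recorded, not its closure properties.

Topology : ∀ ℓ → Set → Set (lsuc ℓ ⊔ lsuc 0ℓ)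
Topology ℓ X = Pred X 0ℓ → Set ℓ

discrete : {X : Set} → Topology 0ℓ X
discrete _ = ⊤

-- The product topology on I → X: an open set contains, around each of
-- its points ρ, a cylinder constraining finitely many coordinates xs.

product : ∀ {ℓ} (I : Set) {X : Set} → Topology ℓ X →
          Topology (ℓ ⊔ lsuc 0ℓ) (I → X)
product I {X} Open W =
  ∀ ρ → W ρ →
  Σ[ xs ∈ List I ] Σ[ O ∈ (I → Pred X 0ℓ) ]
    (∀ x → Open (O x)) ×
    (∀ {x} → x ∈ xs → O x (ρ x)) ×
    (∀ σ → (∀ {x} → x ∈ xs → O x (σ x)) → W σ)

-- The σ-algebra generated by the open sets.  Sets are predicates, so
-- the constructor `resp` is what identifies equivalent predicates.

data Borel {ℓ} {X : Set} (Open : Topology ℓ X) : Pred X 0ℓ → Set (ℓ ⊔ lsuc 0ℓ) where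
  open′ : ∀ {A} → Open A → Borel Open A
  compl : ∀ {A} → Borel Open A → Borel Open (∁ A)
  union : ∀ {A : ℕ → Pred X 0ℓ} → (∀ n → Borel Open (A n)) → Borel Open (⋃ ℕ A)
  resp  : ∀ {A B} → A ≐ B → Borel Open A → Borel Open B

Measurable : ∀ {ℓ₁ ℓ₂} {X Y : Set} → Topology ℓ₁ X → Topology ℓ₂ Y →
             (X → Y) → Set (ℓ₁ ⊔ ℓ₂ ⊔ lsuc 0ℓ)
Measurable OpenX OpenY f = ∀ B → Borel OpenY B → Borel OpenX (f ⊢ B)

data Op : Set where
  plus minus times over : Op

data Rel : Set where
  le lt eq ne : Rel

module Syntax (𝒱 : Set) where

  data Expr : Set where
    const : ℚ → Expr
    var   : 𝒱 → Expr
    neg   : Expr → Expr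
    bin   : Op → Expr → Expr → Expr

  data Test : Set where
    cmp : Rel → Expr → Expr → Test
    !_  : Test → Test

  infix  5 _≔_
  infixr 4 _⨾_

  data Instr : Set where
    skip  : Instr
    _≔_   : 𝒱 → Expr → Instr
    cond  : Test → Instr → Instr → Instr     -- if t then P₁ else P₀
    while : Test → Instr → Instr
    _⨾_   : Instr → Instr → Instr

pattern err = nothing

module Values (em : ExcludedMiddle 0ℓ) (𝓡 : Reals) where
  open Reals 𝓡
  open IsCommutativeRing isCommutativeRing using (+-identityˡ)
  open IsTotalOrder isTotalOrder using (reflexive; trans)

  ℝₑ : Set
  ℝₑ = Maybe ℝ

  negₑ : ℝₑ → ℝₑ
  negₑ = Maybe.map -_

  opₑ : Op → ℝₑ → ℝₑ → ℝₑ
  opₑ plus  = Maybe.zipWith _+_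
  opₑ minus = Maybe.zipWith (λ x y → x + - y)
  opₑ times = Maybe.zipWith _*_
  opₑ over  (just x) (just y) = if does (em {y ≡ 0#}) then err else just (x * y ⁻¹)
  opₑ over  err      _        = err
  opₑ over  (just _) err      = err

  ⟪_⟫ : Rel → ℝ → ℝ → Set
  ⟪ le ⟫ x y = x ≤ y
  ⟪ lt ⟫ x y = x < y
  ⟪ eq ⟫ x y = x ≡ y
  ⟪ ne ⟫ x y = x ≢ y

  openℝ : Topology 0ℓ ℝ
  openℝ W = ∀ r → W r → ∃[ ε ] 0# < ε × (∀ s → r + - ε < s → s < r + ε → W s)

  -- The opens are the sets W and W ∪ {err} with W open in ℝ.
  openℝₑ : Topology 0ℓ ℝₑ
  openℝₑ W = openℝ (just ⊢ W)

  -- The proof of non-negativity is irrelevant, so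
  -- equality in ℝ≥0 is equality of the underlying reals.

  ℝ≥0 : Set
  ℝ≥0 = [ r ∈ ℝ ∣ 0# ≤ r ]

  Ans : Set
  Ans = ℝ≥0 ⁺

  pattern ∞ = ⊤⁺

  open Supremum (λ (r s : ℝ≥0) → value r ≤ value s) public
    using () renaming (_≤⁺_ to _≤ₐ_)

  +-nonNegative : ∀ {x y} → 0# ≤ x → 0# ≤ y → 0# ≤ x + y
  +-nonNegative {x} {y} 0≤x 0≤y =
    trans 0≤y (trans (reflexive (sym (+-identityˡ y))) (+-monoˡ-≤ y 0≤x))

  0ₐ : Ans
  0ₐ = [ 0# , [ reflexive refl ] ]

  infixl 6 _+ₐ_
  infixl 7 _*ₐ_

  _+ₐ_ : Ans → Ans → Ans
  [ r , p ] +ₐ [ s , q ] = [ r + s , Irr.zipWith +-nonNegative p q ]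
  [ _ ]     +ₐ ∞         = ∞
  ∞         +ₐ _         = ∞

  -- x × (+∞)
  _*∞ : Ans → Ans
  [ r , _ ] *∞ = if does (em {r ≡ 0#}) then 0ₐ else ∞
  ∞         *∞ = ∞

  _*ₐ_ : Ans → Ans → Ans
  [ r , p ] *ₐ [ s , q ] = [ r * s , Irr.zipWith *-nonNegative p q ]
  [ r ]     *ₐ ∞         = [ r ] *∞
  ∞         *ₐ y         = y *∞

  openAns : Topology 0ℓ Ans
  openAns W =
    (∀ r → W [ r ] → ∃[ ε ] 0# < ε ×
       (∀ s → value r + - ε < value s → value s < value r + ε → W [ s ])) ×
    (W ∞ → ∃[ m ] ∀ s → m < value s → W [ s ])

  -- Suprema of arbitrary families in Ans.  If the family has a finite
  -- upper bound, its supremum is that of the real set {0} ∪ {a i},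
  -- where 0 only matters for the empty family; otherwise it is ∞.

  module _ {I : Set} (a : I → Ans) where

    FiniteBound : Set
    FiniteBound = ∃[ b ] ∀ i → a i ≤ₐ [ b ]

    range₀ : Pred ℝ 0ℓ
    range₀ x = x ≡ 0# ⊎ ∃[ i ] ∃[ p ] a i ≡ [ x , p ]

    range₀-bounded : FiniteBound → ∃ (UpperBound range₀)
    range₀-bounded ((b , [ 0≤b ]) , a≤b) = b , bound
      where
      0≤b′ : 0# ≤ b
      0≤b′ = recompute em 0≤b

      bound : UpperBound range₀ b
      bound (inj₁ refl) = 0≤b′
      bound (inj₂ (i , _ , aᵢ≡x)) with a i | a≤b i
      bound (inj₂ (i , _ , refl)) | _ | Supremum.[ x≤b ] = x≤b

    ⨆-dec : Dec FiniteBound → Ans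
    ⨆-dec (no _)  = ∞
    ⨆-dec (yes b) =
      let s , ub , _ = complete range₀ (0# , inj₁ refl) (range₀-bounded b)
      in [ s , [ ub (inj₁ refl) ] ]

    ⨆ : Ans
    ⨆ = ⨆-dec em

  record FloatingPoint : Set₁ where
    field
      floats : List ℝ

    𝔽 : Set
    𝔽 = [ x ∈ ℝ ∣ x ∈ floats ]

    𝔽ₑ : Set
    𝔽ₑ = Maybe 𝔽

    inj : 𝔽ₑ → ℝₑ
    inj = Maybe.map value

    field
      Fmin Fmax : 𝔽
      Fmin-min  : ∀ (f : 𝔽) → value Fmin ≤ value f
      Fmax-max  : ∀ (f : 𝔽) → value f ≤ value Fmax

      proj            : ℝₑ → 𝔽ₑ
      proj-measurable : Measurable openℝₑ discrete proj
      proj-overflow   : ∀ r → ¬ (value Fmin ≤ r × r ≤ value Fmax) → proj (just r) ≡ err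
      proj-inj        : ∀ f → proj (inj f) ≡ f

  module _ {ℓ} {X : Set} (Open : Topology ℓ X) where

    𝓜₊ : Pred (X → Ans) (ℓ ⊔ lsuc 0ℓ)
    𝓜₊ = Measurable Open openAns

    -- F is given on all functions X → Ans; the axioms concern its
    -- restriction to 𝓜₊(X).  Equality and order of functions are
    -- pointwise.
    record IsParametricPrevision (F : (X → Ans) → (X → Ans)) : Set (ℓ ⊔ lsuc 0ℓ) where
      field
        closed      : ∀ f → 𝓜₊ f → 𝓜₊ (F f)
        homogeneous : ∀ (α : ℝ≥0) f → 𝓜₊ f →
                      ∀ x → F (λ y → [ α ] *ₐ f y) x ≡ [ α ] *ₐ F f x
        monotonic   : ∀ f g → 𝓜₊ f → 𝓜₊ g →
                      (∀ x → f x ≤ₐ g x) → ∀ x → F f x ≤ₐ F g x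

    IsUpper : ((X → Ans) → (X → Ans)) → Set (ℓ ⊔ lsuc 0ℓ)
    IsUpper F = ∀ f g → 𝓜₊ f → 𝓜₊ g →
                ∀ x → F (λ y → f y +ₐ g y) x ≤ₐ F f x +ₐ F g x

    IsωContinuous : ((X → Ans) → (X → Ans)) → Set (ℓ ⊔ lsuc 0ℓ)
    IsωContinuous F = ∀ (f : ℕ → X → Ans) → (∀ n → 𝓜₊ (f n)) →
                      (∀ n x → f n x ≤ₐ f (suc n) x) →
                      ∀ x → F (λ y → ⨆ (λ n → f n y)) x ≡ ⨆ (λ n → F (f n) x)

data Mode : Set where
  real float : Mode

module Semantics (em : ExcludedMiddle 0ℓ) (𝓡 : Reals)
                 (𝓕 : Values.FloatingPoint em 𝓡) (𝒱 : Set) where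
  open Reals 𝓡 using (fromℚ)
  open Values em 𝓡
  open FloatingPoint 𝓕
  open Syntax 𝒱

  Val : Mode → Set
  Val real  = ℝₑ
  Val float = 𝔽ₑ

  Env : Mode → Set
  Env ⋆ = 𝒱 → Val ⋆

  openVal : (⋆ : Mode) → Topology 0ℓ (Val ⋆)
  openVal real  = openℝₑ
  openVal float = discrete

  openEnv : (⋆ : Mode) → Topology (lsuc 0ℓ) (Env ⋆)
  openEnv ⋆ = product 𝒱 (openVal ⋆)

  _[_↦_] : ∀ {⋆} → Env ⋆ → 𝒱 → Val ⋆ → Env ⋆
  (ρ [ x ↦ v ]) y = if does (em {y ≡ x}) then v else ρ y

  ⟦_⟧ᵣ : Expr → Env real → ℝₑ
  ⟦ const a ⟧ᵣ     ρ = just (fromℚ a)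
  ⟦ var x ⟧ᵣ       ρ = ρ x
  ⟦ neg e ⟧ᵣ       ρ = negₑ (⟦ e ⟧ᵣ ρ)
  ⟦ bin ◇ e₁ e₂ ⟧ᵣ ρ = opₑ ◇ (⟦ e₁ ⟧ᵣ ρ) (⟦ e₂ ⟧ᵣ ρ)

  ⟦_⟧f : Expr → Env float → 𝔽ₑ
  ⟦ const a ⟧f     ρ = proj (just (fromℚ a))
  ⟦ var x ⟧f       ρ = ρ x
  ⟦ neg e ⟧f       ρ = proj (negₑ (inj (⟦ e ⟧f ρ)))
  ⟦ bin ◇ e₁ e₂ ⟧f ρ = proj (opₑ ◇ (inj (⟦ e₁ ⟧f ρ)) (inj (⟦ e₂ ⟧f ρ)))

  ⟦_⟧ : Expr → (⋆ : Mode) → Env ⋆ → Val ⋆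
  ⟦ e ⟧ real  = ⟦ e ⟧ᵣ
  ⟦ e ⟧ float = ⟦ e ⟧f

  toℝₑ : (⋆ : Mode) → Val ⋆ → ℝₑ
  toℝₑ real  = id
  toℝₑ float = inj

  -- Subsets of {0,1} are predicates on Bool, with true for 1.

  compare : Rel → ℝₑ → ℝₑ → Pred Bool 0ℓ
  compare R (just x) (just y) = ｛ does (em {⟪ R ⟫ x y}) ｝
  compare R err      _        = U
  compare R (just _) err      = U

  ⟦_⟧ᵗ : Test → (⋆ : Mode) → Env ⋆ → Pred Bool 0ℓ
  ⟦ cmp R e₁ e₂ ⟧ᵗ ⋆ ρ = compare R (toℝₑ ⋆ (⟦ e₁ ⟧ ⋆ ρ)) (toℝₑ ⋆ (⟦ e₂ ⟧ ⋆ ρ))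
  ⟦ ! t ⟧ᵗ         ⋆ ρ = λ w → ∃[ v ] ⟦ t ⟧ᵗ ⋆ ρ v × w ≡ not v

  module _ (⋆ : Mode) where

    Cont : Set
    Cont = Env ⋆ → Ans

    -- The supremum of κ₁ ρ (if 1 ∈ ⟦ t ⟧) and κ₀ ρ (if 0 ∈ ⟦ t ⟧).
    branch : Test → Cont → Cont → Cont
    branch t κ₁ κ₀ ρ =
      ⨆ {I = ∃ (⟦ t ⟧ᵗ ⋆ ρ)} (λ i → if proj₁ i then κ₁ ρ else κ₀ ρ)

    -- W stands for wp ⋆ P.
    H : Test → (Cont → Cont) → (Cont → Cont) → (Cont → Cont)
    H t W φ κ = branch t (W (φ κ)) κ

    wp : Instr → Cont → Cont
    wp skip                  κ   = κ
    wp (x ≔ e)               κ ρ = κ (ρ [ x ↦ ⟦ e ⟧ ⋆ ρ ])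
    wp (P ⨾ Q)               κ   = wp P (wp Q κ)
    wp (cond t P₁ P₀)        κ   = branch t (wp P₁ κ) (wp P₀ κ)
    wp (while t P)           κ ρ =
      ⨆ (λ n → fold (λ _ _ → 0ₐ) (H t (wp P)) n κ ρ)

{-# OPTIONS --safe #-}

-- Monotonicity, homogeneity, subadditivity and ω-continuity of wp P hold on all functions, not just
-- on measurable ones: each is preserved by composition, by the suprema that interpret tests, and by
-- the supremum over the approximants of a loop, because suprema in [0,∞] commute with each other and
-- with scaling and are subadditive.  Only closure of 𝓜₊ needs measure theory.  There the point is that
-- ρ ↦ ρ[x ↦ ⟦e⟧ρ] is Borel for the product topology, which uses that there are countably many
-- variables and that every open set of values is a countable union of cells.

module Submission where

open import Defs
open import Algebra.Bundles using (CommutativeRing)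
open import Axiom.ExcludedMiddle using (ExcludedMiddle)
open import Data.Bool.Base using (true; false; not; if_then_else_)
open import Data.Bool.Properties using (not-involutive)
open import Data.Empty using (⊥)
open import Data.Fin.Base using (toℕ)
open import Data.Fin.Properties using (toℕ-injective)
open import Data.Irrelevant using ([_])
open import Data.List.Base using (List; []; _∷_; lookup)
open import Data.List.Membership.Propositional using (_∈_)
open import Data.List.Relation.Unary.All using (All; []; _∷_)
open import Data.List.Relation.Unary.Any using (here; there; index)
open import Data.List.Relation.Unary.Any.Properties using (lookup-index)
open import Data.Maybe.Base as Maybe using (Maybe; just; nothing)
open import Data.Maybe.Relation.Unary.Any as Any using (Any; just)
open import Data.Nat.Base using (ℕ; zero; suc)
open import Data.Nat.GeneralisedArithmetic using (fold)
open import Data.Product.Base using (Σ; Σ-syntax; ∃; ∃-syntax; _×_; _,_; proj₁; proj₂)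
open import Data.Refinement.Base using (value; _,_)
open import Data.Sum.Base using (_⊎_; inj₁; inj₂; [_,_]′)
open import Data.Unit.Base using (tt)
open import Data.Vec.Base as Vec using (Vec; []; _∷_)
open import Data.Vec.Properties using (toList∘fromList)
open import Function.Base using (_∘_)
open import Function.Bundles using (_↣_; module Injection)
open import Function.Definitions using (Injective)
open import Level using (Level; 0ℓ) renaming (suc to lsuc)
open import Relation.Binary.Bundles using (Poset)
open import Relation.Binary.PropositionalEquality
  using (_≡_; _≢_; refl; sym; trans; cong; cong₂; subst; subst₂; isEquivalence)
open import Relation.Binary.Structures using (IsTotalOrder)
open import Relation.Nullary using (¬_; does; yes; no; contradiction)
open import Relation.Nullary.Construct.Add.Supremum using ([_])
open import Relation.Nullary.Decidable using (decidable-stable; recompute)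
open import Relation.Unary using (Pred; U; ∁; ⋃; _∩_; _∪_; _⇒_; _⊢_)
import Algebra.Properties.AbelianGroup as AbelianGroupProperties
import Algebra.Properties.Ring as RingProperties
import Relation.Binary.Construct.Add.Supremum.NonStrict as Supremum
import Relation.Binary.Reasoning.PartialOrder as PosetReasoning

-- The obstacle is that Borel sets of environments are generated by all opens of the product, each a
-- priori an uncountable union of cylinders, whereas coordinatewise arguments only reach cylinders.
-- `Network` removes it: cells such that every point of an open set lies in a cell contained in that
-- set. When the cells are countably indexed, checking preimages of cells suffices, and networks
-- pass to products as finite lists of constraints. Since cells may be half-open, each is cut out by
-- one-sided inequalities. Measurability of a map into `ℝₑ` thus comes down to the sets where it is
-- below c, and that of a map into `Ans` to the sets where it is at most c; the second form turns
-- suprema into intersections. Sums are then treated by separating with fractions, products by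
-- polarisation, quotients by inversion on either side of 0. Excluded middle picks out which cells
-- lie in a given open set, so no enumeration of them has to be computed.

-- Ordered-field arithmetic, the Archimedean property and a countable dense set.

module OrderedField (em : ExcludedMiddle 0ℓ) (𝓡 : Reals) where
  open Reals 𝓡 public

  commutativeRing : CommutativeRing 0ℓ 0ℓ
  commutativeRing = record { isCommutativeRing = isCommutativeRing }

  open CommutativeRing commutativeRing public
    using (+-comm; +-assoc; +-identityˡ; *-comm; *-assoc; *-identityˡ;
           *-identityʳ; distribˡ; distribʳ; zeroˡ; zeroʳ; -‿inverseʳ)
  open CommutativeRing commutativeRing using (ring; +-abelianGroup)
  open AbelianGroupProperties +-abelianGroup
    using (//-rightDividesˡ; //-rightDividesʳ; xyx⁻¹≈y)
    renaming (∙-cancelʳ to +-cancelʳ; ⁻¹-involutive to -‿involutive;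
              ⁻¹-anti-homo‿- to -‿anti-homo; ε⁻¹≈ε to -0≡0)
  open RingProperties ring using (-‿distribˡ-*; -‿distribʳ-*)

  poset : Poset 0ℓ 0ℓ 0ℓ
  poset = record { isPartialOrder = isPartialOrder }
    where open IsTotalOrder isTotalOrder using (isPartialOrder)

  open Poset poset public using () renaming
    (refl to ≤-refl; reflexive to ≤-reflexive; trans to ≤-trans; antisym to ≤-antisym)
  open IsTotalOrder isTotalOrder public using () renaming (total to ≤-total)
  open PosetReasoning poset

  <⇒≤ : ∀ {x y} → x < y → x ≤ y
  <⇒≤ = proj₁

  <-irrefl : ∀ {x} → ¬ x < x
  <-irrefl (_ , x≢x) = x≢x refl

  <-trans : ∀ {x y z} → x < y → y < z → x < z
  <-trans {x} {y} {z} x<y y<z = begin-strict x <⟨ x<y ⟩ y <⟨ y<z ⟩ z ∎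

  ≤-<-trans : ∀ {x y z} → x ≤ y → y < z → x < z
  ≤-<-trans {x} {y} {z} x≤y y<z = begin-strict x ≤⟨ x≤y ⟩ y <⟨ y<z ⟩ z ∎

  <-≤-trans : ∀ {x y z} → x < y → y ≤ z → x < z
  <-≤-trans {x} {y} {z} x<y y≤z = begin-strict x <⟨ x<y ⟩ y ≤⟨ y≤z ⟩ z ∎

  <⇒≱ : ∀ {x y} → x < y → ¬ y ≤ x
  <⇒≱ (x≤y , x≢y) y≤x = x≢y (≤-antisym x≤y y≤x)

  ≰⇒> : ∀ {x y} → ¬ x ≤ y → y < x
  ≰⇒> {x} {y} x≰y with ≤-total x y
  ... | inj₁ x≤y = contradiction x≤y x≰y
  ... | inj₂ y≤x = y≤x , λ { refl → x≰y ≤-refl }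

  ≮⇒≥ : ∀ {x y} → ¬ x < y → y ≤ x
  ≮⇒≥ x≮y = decidable-stable em λ y≰x → x≮y (≰⇒> y≰x)

  +-monoˡ-< : ∀ {x y} z → x < y → x + z < y + z
  +-monoˡ-< z (x≤y , x≢y) = +-monoˡ-≤ z x≤y , λ eq → x≢y (+-cancelʳ z _ _ eq)

  +-mono-≤ : ∀ {x y u v} → x ≤ y → u ≤ v → x + u ≤ y + v
  +-mono-≤ {x} {y} {u} {v} x≤y u≤v = begin
    x + u ≤⟨ +-monoˡ-≤ u x≤y ⟩
    y + u ≡⟨ +-comm y u ⟩
    u + y ≤⟨ +-monoˡ-≤ y u≤v ⟩
    v + y ≡⟨ +-comm v y ⟩
    y + v ∎

  x+[y-x]≡y : ∀ x y → x + (y + - x) ≡ y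
  x+[y-x]≡y x y = trans (sym (+-assoc x y (- x))) (xyx⁻¹≈y x y)

  x-[x-y]≡y : ∀ x y → x + - (x + - y) ≡ y
  x-[x-y]≡y x y = trans (cong (x +_) (-‿anti-homo x y)) (x+[y-x]≡y x y)

  +<⇒<- : ∀ {x y c} → x + y < c → x < c + - y
  +<⇒<- {x} {y} x+y<c =
    subst (_< _) (//-rightDividesʳ y x) (+-monoˡ-< (- y) x+y<c)

  <-⇒+< : ∀ {x y c} → x < c + - y → x + y < c
  <-⇒+< {x} {y} {c} x<c-y = subst (_ <_) (//-rightDividesˡ y c) (+-monoˡ-< y x<c-y)

  x<y⇒0<y-x : ∀ {x y} → x < y → 0# < y + - x
  x<y⇒0<y-x x<y = +<⇒<- (subst (_< _) (sym (+-identityˡ _)) x<y)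

  x<x+ε : ∀ {x ε} → 0# < ε → x < x + ε
  x<x+ε {x} {ε} 0<ε = begin-strict
    x      ≡⟨ sym (+-identityˡ x) ⟩
    0# + x <⟨ +-monoˡ-< x 0<ε ⟩
    ε + x  ≡⟨ +-comm ε x ⟩
    x + ε  ∎

  x-ε<x : ∀ {x ε} → 0# < ε → x + - ε < x
  x-ε<x {x} {ε} 0<ε =
    subst (x + - ε <_) (//-rightDividesˡ ε x) (x<x+ε 0<ε)

  neg-antitone : ∀ {x y} → x ≤ y → - y ≤ - x
  neg-antitone {x} {y} x≤y = begin
    - y               ≡⟨ sym (x+[y-x]≡y x (- y)) ⟩
    x + (- y + - x)   ≤⟨ +-monoˡ-≤ _ x≤y ⟩
    y + (- y + - x)   ≡⟨ cong (y +_) (+-comm (- y) (- x)) ⟩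
    y + (- x + - y)   ≡⟨ x+[y-x]≡y y (- x) ⟩
    - x               ∎

  neg-nonPositive : ∀ {x} → x ≤ 0# → 0# ≤ - x
  neg-nonPositive x≤0 = subst (_≤ _) -0≡0 (neg-antitone x≤0)

  *-monoˡ-≤ : ∀ {x y z} → 0# ≤ z → x ≤ y → x * z ≤ y * z
  *-monoˡ-≤ {x} {y} {z} 0≤z x≤y = begin
    x * z                    ≡⟨ sym (+-identityˡ _) ⟩
    0# + x * z               ≤⟨ +-monoˡ-≤ _ (*-nonNegative 0≤y-x 0≤z) ⟩
    (y + - x) * z + x * z    ≡⟨ sym (distribʳ z (y + - x) x) ⟩
    (y + - x + x) * z        ≡⟨ cong (_* z) (//-rightDividesˡ x y) ⟩
    y * z                    ∎
    where
    0≤y-x : 0# ≤ y + - x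
    0≤y-x = subst (_≤ _) (-‿inverseʳ x) (+-monoˡ-≤ (- x) x≤y)

  x*y*y⁻¹≡x : ∀ x {y} → y ≢ 0# → x * y * y ⁻¹ ≡ x
  x*y*y⁻¹≡x x {y} y≢0 =
    trans (*-assoc x y (y ⁻¹)) (trans (cong (x *_) (⁻¹-inverseʳ y≢0)) (*-identityʳ x))

  0<⇒≢0 : ∀ {x} → 0# < x → x ≢ 0#
  0<⇒≢0 (_ , 0≢x) x≡0 = 0≢x (sym x≡0)

  *-monoˡ-< : ∀ {x y z} → 0# < z → x < y → x * z < y * z
  *-monoˡ-< {x} {y} {z} 0<z (x≤y , x≢y) =
    *-monoˡ-≤ (<⇒≤ 0<z) x≤y , λ eq → x≢y
      (trans (sym (x*y*y⁻¹≡x x z≢0)) (trans (cong (_* z ⁻¹) eq) (x*y*y⁻¹≡x y z≢0)))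
    where
    z≢0 : z ≢ 0#
    z≢0 = 0<⇒≢0 0<z

  -x*-y≡x*y : ∀ x y → - x * - y ≡ x * y
  -x*-y≡x*y x y =
    trans (sym (-‿distribˡ-* x (- y))) (trans (cong -_ (sym (-‿distribʳ-* x y))) (-‿involutive _))

  *-nonPositive : ∀ {x y} → x ≤ 0# → y ≤ 0# → 0# ≤ x * y
  *-nonPositive x≤0 y≤0 =
    subst (0# ≤_) (-x*-y≡x*y _ _) (*-nonNegative (neg-nonPositive x≤0) (neg-nonPositive y≤0))

  0≤x*x : ∀ x → 0# ≤ x * x
  0≤x*x x with ≤-total 0# x
  ... | inj₁ 0≤x = *-nonNegative 0≤x 0≤x
  ... | inj₂ x≤0 = *-nonPositive x≤0 x≤0

  0<1 : 0# < 1#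
  0<1 = subst (0# ≤_) (*-identityˡ 1#) (0≤x*x 1#) , 0≢1

  ⁻¹-positive : ∀ {x} → 0# < x → 0# < x ⁻¹
  ⁻¹-positive {x} 0<x = ≰⇒> λ x⁻¹≤0 → <⇒≱ 0<1 (begin
    1#        ≡⟨ sym (⁻¹-inverseʳ (0<⇒≢0 0<x)) ⟩
    x * x ⁻¹  ≡⟨ *-comm x (x ⁻¹) ⟩
    x ⁻¹ * x  ≤⟨ *-monoˡ-≤ (<⇒≤ 0<x) x⁻¹≤0 ⟩
    0# * x    ≡⟨ zeroˡ x ⟩
    0#        ∎)

  ⁻¹-nonPositive : ∀ {x} → x < 0# → x ⁻¹ ≤ 0#
  ⁻¹-nonPositive {x} x<0@(x≤0 , x≢0) = ≮⇒≥ λ 0<x⁻¹ → <⇒≱ 0<1 (begin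
    1#         ≡⟨ sym (⁻¹-inverseʳ x≢0) ⟩
    x * x ⁻¹   ≤⟨ *-monoˡ-≤ (<⇒≤ 0<x⁻¹) x≤0 ⟩
    0# * x ⁻¹  ≡⟨ zeroˡ _ ⟩
    0#         ∎)

  -- Multiply x ≤ y by `x ⁻¹ * y ⁻¹`. Asking for the sign of this product covers two positive and
  -- two negative arguments at once.
  ⁻¹-antitone : ∀ {x y} → x ≢ 0# → y ≢ 0# → 0# ≤ x ⁻¹ * y ⁻¹ → x ≤ y → y ⁻¹ ≤ x ⁻¹
  ⁻¹-antitone {x} {y} x≢0 y≢0 0≤p x≤y = begin
    y ⁻¹                ≡⟨ sym (x*y*y⁻¹≡x (y ⁻¹) x≢0) ⟩
    y ⁻¹ * x * x ⁻¹     ≡⟨ cong (_* x ⁻¹) (*-comm (y ⁻¹) x) ⟩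
    x * y ⁻¹ * x ⁻¹     ≡⟨ *-assoc x (y ⁻¹) (x ⁻¹) ⟩
    x * (y ⁻¹ * x ⁻¹)   ≡⟨ cong (x *_) (*-comm (y ⁻¹) (x ⁻¹)) ⟩
    x * (x ⁻¹ * y ⁻¹)   ≤⟨ *-monoˡ-≤ 0≤p x≤y ⟩
    y * (x ⁻¹ * y ⁻¹)   ≡⟨ sym (*-assoc y (x ⁻¹) (y ⁻¹)) ⟩
    y * x ⁻¹ * y ⁻¹     ≡⟨ cong (_* y ⁻¹) (*-comm y (x ⁻¹)) ⟩
    x ⁻¹ * y * y ⁻¹     ≡⟨ x*y*y⁻¹≡x (x ⁻¹) y≢0 ⟩
    x ⁻¹                ∎

  square-mono : ∀ {x y} → 0# ≤ x → x ≤ y → x * x ≤ y * y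
  square-mono {x} {y} 0≤x x≤y = begin
    x * x ≤⟨ *-monoˡ-≤ 0≤x x≤y ⟩
    y * x ≡⟨ *-comm y x ⟩
    x * y ≤⟨ *-monoˡ-≤ (≤-trans 0≤x x≤y) x≤y ⟩
    y * y ∎

  square-antitone : ∀ {x y} → x ≤ y → y ≤ 0# → y * y ≤ x * x
  square-antitone {x} {y} x≤y y≤0 =
    subst₂ _≤_ (-x*-y≡x*y y y) (-x*-y≡x*y x x)
      (square-mono (neg-nonPositive y≤0) (neg-antitone x≤y))

  ½ : ℝ
  ½ = (1# + 1#) ⁻¹

  0<1+1 : 0# < 1# + 1#
  0<1+1 = <-trans 0<1 (x<x+ε 0<1)

  [x+x]½≡x : ∀ x → (x + x) * ½ ≡ x
  [x+x]½≡x x = trans (cong (_* ½) x+x≡x2) (x*y*y⁻¹≡x x (0<⇒≢0 0<1+1))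
    where
    x+x≡x2 : x + x ≡ x * (1# + 1#)
    x+x≡x2 = sym (trans (distribˡ x 1# 1#) (cong₂ _+_ (*-identityʳ x) (*-identityʳ x)))

  -- Expresses a product through sums, squares and halving, so that multiplication becomes
  -- measurable from addition and functions of one variable.
  polarisation : ∀ x y → ((x + y) * (x + y) + - (x * x + y * y)) * ½ ≡ x * y
  polarisation x y = trans (cong (_* ½) lemma) ([x+x]½≡x (x * y))
    where
    square-sum : (x + y) * (x + y) ≡ (x * y + x * y) + (x * x + y * y)
    square-sum = begin-equality
      (x + y) * (x + y)                     ≡⟨ distribʳ (x + y) x y ⟩
      x * (x + y) + y * (x + y)             ≡⟨ cong₂ _+_ (distribˡ x x y) (distribˡ y x y) ⟩
      (x * x + x * y) + (y * x + y * y)     ≡⟨ cong₂ _+_ (+-comm _ _) (cong (_+ y * y) (*-comm y x)) ⟩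
      (x * y + x * x) + (x * y + y * y)     ≡⟨ +-assoc _ _ _ ⟩
      x * y + (x * x + (x * y + y * y))     ≡⟨ cong (x * y +_) (sym (+-assoc _ _ _)) ⟩
      x * y + (x * x + x * y + y * y)       ≡⟨ cong (λ z → x * y + (z + y * y)) (+-comm _ _) ⟩
      x * y + (x * y + x * x + y * y)       ≡⟨ cong (x * y +_) (+-assoc _ _ _) ⟩
      x * y + (x * y + (x * x + y * y))     ≡⟨ sym (+-assoc _ _ _) ⟩
      (x * y + x * y) + (x * x + y * y)     ∎

    lemma : (x + y) * (x + y) + - (x * x + y * y) ≡ x * y + x * y
    lemma = trans (cong (_+ - (x * x + y * y)) square-sum) (//-rightDividesʳ (x * x + y * y) (x * y + x * y))

  abstract
    -- If x bounded the naturals, their supremum s would satisfy n + 1 ≤ s for all n, making s - 1 a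
    -- smaller upper bound.
    archimedean : ∀ x → ∃[ n ] x < fromℕ n
    archimedean x = decidable-stable em λ unbounded →
      let bound : UpperBound (λ y → ∃[ n ] y ≡ fromℕ n) x
          bound = λ { (n , refl) → ≮⇒≥ λ x<n → unbounded (n , x<n) }
          s , s-upper , s-least = complete (λ y → ∃[ n ] y ≡ fromℕ n) (0# , 0 , refl) (x , bound)
          s-1-upper : UpperBound (λ y → ∃[ n ] y ≡ fromℕ n) (s + - 1#)
          s-1-upper = λ { (n , refl) → subst (_≤ s + - 1#) (xyx⁻¹≈y 1# (fromℕ n))
                                         (+-monoˡ-≤ (- 1#) (s-upper (suc n , refl))) }
      in <⇒≱ (x-ε<x 0<1) (s-least s-1-upper)

  -- Descends from a known bound n until x is no longer below the predecessor; that failure is the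
  -- second inequality.
  ceiling : ∀ n {x} → 0# ≤ x → x < fromℕ n → ∃[ j ] x < fromℕ j × fromℕ j ≤ 1# + x
  ceiling zero    0≤x x<0 = contradiction 0≤x (<⇒≱ x<0)
  ceiling (suc n) {x} 0≤x x<1+n with em {x < fromℕ n}
  ... | yes x<n = ceiling n 0≤x x<n
  ... | no  x≮n = suc n , x<1+n , +-mono-≤ ≤-refl (≮⇒≥ x≮n)

  -- Codes for (j - k) / n. Plain triples of naturals make countability immediate, and repeated
  -- values do no harm.
  Fraction : Set
  Fraction = ℕ × ℕ × ℕ

  -- Unspecified for n = 0, which is harmless: only density of the range matters.
  fraction : Fraction → ℝ
  fraction (j , k , n) = (fromℕ j + - fromℕ k) * (fromℕ n) ⁻¹

  abstract
    -- Choosing n above 1 / (y - x) stretches the interval to length greater than 1, so an integer j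
    -- - k lies strictly between xn and yn.
    fraction-dense : ∀ {x y} → x < y → ∃[ q ] x < fraction q × fraction q < y
    fraction-dense {x} {y} x<y =
      let 0<δ = x<y⇒0<y-x x<y
          n , δ⁻¹<n = archimedean ((y + - x) ⁻¹)
          ν = fromℕ n
          0<ν = <-trans (⁻¹-positive 0<δ) δ⁻¹<n
          0<ν⁻¹ = ⁻¹-positive 0<ν
          -- The shift by k makes xν + k positive, because `ceiling` only rounds nonnegative
          -- numbers.
          k , -xν<k = archimedean (- (x * ν))
          κ = fromℕ k
          0<xν+κ = begin-strict
            0#                  ≡⟨ sym (-‿inverseʳ (x * ν)) ⟩
            x * ν + - (x * ν)   ≡⟨ +-comm _ _ ⟩
            - (x * ν) + x * ν   <⟨ +-monoˡ-< (x * ν) -xν<k ⟩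
            κ + x * ν           ≡⟨ +-comm _ _ ⟩
            x * ν + κ           ∎
          m , xν+κ<m = archimedean (x * ν + κ)
          j , xν+κ<j , j≤1+xν+κ = ceiling m (<⇒≤ 0<xν+κ) xν+κ<m
          xν<j-κ = +<⇒<- xν+κ<j
          1<δν = begin-strict
            1#                          ≡⟨ sym (⁻¹-inverseʳ (0<⇒≢0 0<δ)) ⟩
            (y + - x) * (y + - x) ⁻¹    ≡⟨ *-comm _ _ ⟩
            (y + - x) ⁻¹ * (y + - x)    <⟨ *-monoˡ-< 0<δ δ⁻¹<n ⟩
            ν * (y + - x)               ≡⟨ *-comm _ _ ⟩
            (y + - x) * ν               ∎
          j-κ<yν = begin-strict
            fromℕ j + - κ               ≤⟨ +-monoˡ-≤ (- κ) j≤1+xν+κ ⟩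
            1# + (x * ν + κ) + - κ      ≡⟨ cong (_+ - κ) (sym (+-assoc _ _ _)) ⟩
            1# + x * ν + κ + - κ        ≡⟨ //-rightDividesʳ κ (1# + x * ν) ⟩
            1# + x * ν                  <⟨ +-monoˡ-< (x * ν) 1<δν ⟩
            (y + - x) * ν + x * ν       ≡⟨ sym (distribʳ ν _ _) ⟩
            (y + - x + x) * ν           ≡⟨ cong (_* ν) (//-rightDividesˡ x y) ⟩
            y * ν                       ∎
      in (j , k , n) ,
         subst (_< fraction (j , k , n)) (x*y*y⁻¹≡x x (0<⇒≢0 0<ν)) (*-monoˡ-< 0<ν⁻¹ xν<j-κ) ,
         subst (fraction (j , k , n) <_) (x*y*y⁻¹≡x y (0<⇒≢0 0<ν)) (*-monoˡ-< 0<ν⁻¹ j-κ<yν)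

-- Networks of cells and their products.

-- Weaker than a countable base: the cells need not be open.
Network : ∀ {ℓ} {B Y : Set} → Topology ℓ Y → (B → Pred Y 0ℓ) → Set _
Network Open cell =
  ∀ {W} → Open W → ∀ {y} → W y → ∃[ β ] (cell β y × (∀ z → cell β z → W z))

-- Coded by a finite list, so that there are countably many cylinders once coordinates and cells are
-- countable. A repeated coordinate imposes both of its constraints.
Cylinder : {I B Y : Set} → (B → Pred Y 0ℓ) → List (I × B) → Pred (I → Y) 0ℓ
Cylinder cell l ρ = All (λ (i , β) → cell β (ρ i)) l

-- An open set of the product contains a box around each of its points; a cell is chosen inside each
-- of the finitely many constrained sides.
product-network : ∀ {ℓ} {I B Y : Set} {Open : Topology ℓ Y} {cell : B → Pred Y 0ℓ} →
                  Network Open cell → Network (product I Open) (Cylinder cell)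
product-network {I = I} {B} {Y} {cell = cell} network W-open {ρ} Wρ
  with xs , O , O-open , ρ∈O , O⊆W ← W-open ρ Wρ =
  let l , ρ∈l , l⊆O = cover xs ρ∈O in l , ρ∈l , λ σ σ∈l → O⊆W σ (l⊆O σ∈l)
  where
  cover : ∀ ys → (∀ {y} → y ∈ ys → O y (ρ y)) →
          Σ[ l ∈ List (I × B) ] Cylinder cell l ρ ×
            (∀ {σ} → Cylinder cell l σ → ∀ {y} → y ∈ ys → O y (σ y))
  cover []       _   = [] , [] , λ _ ()
  cover (y ∷ ys) ρ∈O with network (O-open y) (ρ∈O (here refl)) | cover ys (ρ∈O ∘ there)
  ... | β , ρy∈β , β⊆O | l , ρ∈l , l⊆O = (y , β) ∷ l , ρy∈β ∷ ρ∈l ,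
    λ { (σy∈β ∷ _) (here refl) → β⊆O _ σy∈β
      ; (_ ∷ σ∈l)  (there y∈ys) → l⊆O σ∈l y∈ys }

-- Closure properties of Borel sets and countable index types.

module BorelSets (em : ExcludedMiddle 0ℓ) {ℓ : Level} {X : Set}
                 (Open : Topology ℓ X) (U-borel : Borel Open U) where

  𝓑 : Pred X 0ℓ → Set _
  𝓑 = Borel Open

  private variable A B : Pred X 0ℓ

  -- Either everything or nothing, by excluded middle. Intersecting with such a set restricts a
  -- union over all indices to those with a given property.
  constant-borel : (P : Set) → 𝓑 (λ _ → P)
  constant-borel P with em {P}
  ... | yes p = resp ((λ _ → p) , (λ _ → tt)) U-borel
  ... | no ¬p = resp ((λ ¬U → contradiction tt ¬U) , (λ p → contradiction p ¬p)) (compl U-borel)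

  constant-measurable : ∀ {ℓ′} {Y : Set} {OpenY : Topology ℓ′ Y} y → Measurable Open OpenY (λ _ → y)
  constant-measurable y W _ = constant-borel (W y)

  ∪-borel : 𝓑 A → 𝓑 B → 𝓑 (A ∪ B)
  ∪-borel {A} {B} 𝓑A 𝓑B = resp (to , from) (union {A = pair} λ { zero → 𝓑A ; (suc _) → 𝓑B })
    where
    pair : ℕ → Pred X 0ℓ
    pair zero    = A
    pair (suc _) = B

    to : ∀ {x} → ⋃ ℕ pair x → (A ∪ B) x
    to (zero  , Ax) = inj₁ Ax
    to (suc _ , Bx) = inj₂ Bx

    from : ∀ {x} → (A ∪ B) x → ⋃ ℕ pair x
    from (inj₁ Ax) = 0 , Ax
    from (inj₂ Bx) = 1 , Bx

  ∩-borel : 𝓑 A → 𝓑 B → 𝓑 (A ∩ B)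
  ∩-borel 𝓑A 𝓑B = resp
    ( (λ ¬[¬A∪¬B] → decidable-stable em (¬[¬A∪¬B] ∘ inj₁)
                  , decidable-stable em (¬[¬A∪¬B] ∘ inj₂))
    , (λ (Ax , Bx) → [ (λ ¬Ax → ¬Ax Ax) , (λ ¬Bx → ¬Bx Bx) ]′))
    (compl (∪-borel (compl 𝓑A) (compl 𝓑B)))

  ⇒-borel : 𝓑 A → 𝓑 B → 𝓑 (A ⇒ B)
  ⇒-borel {A} {B} 𝓑A 𝓑B = resp (to , from) (∪-borel (compl 𝓑A) 𝓑B)
    where
    to : ∀ {x} → (∁ A ∪ B) x → (A ⇒ B) x
    to (inj₁ ¬Ax) Ax = contradiction Ax ¬Ax
    to (inj₂ Bx)  _  = Bx

    from : ∀ {x} → (A ⇒ B) x → (∁ A ∪ B) x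
    from {x} f with em {A x}
    ... | yes Ax = inj₂ (f Ax)
    ... | no ¬Ax = inj₁ ¬Ax

  -- Countability is recorded through its effect on unions of Borel sets rather than by an
  -- enumeration, so empty types need no separate case and closure under Σ is a nested union.
  Countable : Set → Set _
  Countable I = {S : I → Pred X 0ℓ} → (∀ i → 𝓑 (S i)) → 𝓑 (⋃ I S)

  ⋂-borel : ∀ {I} → Countable I → {S : I → Pred X 0ℓ} →
            (∀ i → 𝓑 (S i)) → 𝓑 (λ x → ∀ i → S i x)
  ⋂-borel countable 𝓑S = resp
    ( (λ ¬∃¬ i → decidable-stable em λ ¬Sᵢ → ¬∃¬ (i , ¬Sᵢ))
    , (λ ∀S (i , ¬Sᵢ) → ¬Sᵢ (∀S i)))
    (compl (countable (λ i → compl (𝓑S i))))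

  countable-Σ : ∀ {I} {J : I → Set} → Countable I → (∀ i → Countable (J i)) → Countable (Σ I J)
  countable-Σ I-countable J-countable 𝓑S = resp
    ((λ (i , j , s) → (i , j) , s) , (λ ((i , j) , s) → i , j , s))
    (I-countable λ i → J-countable i λ j → 𝓑S (i , j))

  countable-ℕ³ : Countable (ℕ × ℕ × ℕ)
  countable-ℕ³ = countable-Σ union λ _ → countable-Σ union λ _ → union

  countable-image : ∀ {I J} (g : I → J) → (∀ j → ∃[ i ] g i ≡ j) → Countable I → Countable J
  countable-image g surjective I-countable {S} 𝓑S = resp
    ((λ (i , s) → g i , s) , (λ (j , s) → let i , gi≡j = surjective j in
                                          i , subst (λ k → S k _) (sym gi≡j) s))
    (I-countable (𝓑S ∘ g))

  -- The union is regrouped along the fibres of `g`. Each fibre is empty or a single index, and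
  -- excluded middle tells which, so no inverse of `g` is built.
  countable-injection : ∀ {I} (g : I → ℕ) → Injective _≡_ _≡_ g → Countable I
  countable-injection {I} g injective {S} 𝓑S = resp
    ((λ (_ , i , _ , s) → i , s) , (λ (i , s) → g i , i , refl , s))
    (union fibre-borel)
    where
    fibre-borel : ∀ n → 𝓑 (λ x → ∃[ i ] g i ≡ n × S i x)
    fibre-borel n with em {∃[ i ] g i ≡ n}
    ... | yes (i , gi≡n) = resp
      ( (λ s → i , gi≡n , s)
      , (λ (j , gj≡n , s) → subst (λ k → S k _) (injective (trans gj≡n (sym gi≡n))) s))
      (𝓑S i)
    ... | no empty = resp
      ((λ ¬U → contradiction tt ¬U) , (λ (i , gi≡n , _) → contradiction (i , gi≡n) empty))
      (compl U-borel)

  countable-Maybe : ∀ {I} → Countable I → Countable (Maybe I)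
  countable-Maybe {I} I-countable {S} 𝓑S =
    resp (to , from) (∪-borel (𝓑S nothing) (I-countable (𝓑S ∘ just)))
    where
    to : ∀ {x} → (S nothing ∪ ⋃ I (S ∘ just)) x → ⋃ (Maybe I) S x
    to (inj₁ s)       = nothing , s
    to (inj₂ (i , s)) = just i , s

    from : ∀ {x} → ⋃ (Maybe I) S x → (S nothing ∪ ⋃ I (S ∘ just)) x
    from (nothing , s) = inj₁ s
    from (just i  , s) = inj₂ (i , s)

  countable-Vec : ∀ {I} → Countable I → ∀ n → Countable (Vec I n)
  countable-Vec I-countable zero    𝓑S = resp ((λ s → [] , s) , λ { ([] , s) → s }) (𝓑S [])
  countable-Vec I-countable (suc n) =
    countable-image (λ (i , is) → i ∷ is) (λ { (i ∷ is) → (i , is) , refl })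
      (countable-Σ I-countable λ _ → countable-Vec I-countable n)

  countable-List : ∀ {I} → Countable I → Countable (List I)
  countable-List I-countable =
    countable-image (λ (_ , is) → Vec.toList is) (λ is → (_ , Vec.fromList is) , toList∘fromList is)
      (countable-Σ union (countable-Vec I-countable))

  module _ {ℓ′ : Level} {Y B : Set} {OpenY : Topology ℓ′ Y} {cell : B → Pred Y 0ℓ}
           (network : Network OpenY cell) (countable : Countable B)
           {f : X → Y} (cell-borel : ∀ β → 𝓑 (cell β ∘ f)) where

    -- An open W is the union of the cells contained in W, selected by a constant set; complements
    -- and unions commute with preimages.
    network-measurable : Measurable Open OpenY f
    network-measurable W (open′ W-open) = resp
      ( (λ (β , fx∈β , β⊆W) → β⊆W _ fx∈β)
      , (λ fx∈W → let β , fx∈β , β⊆W = network W-open fx∈W in β , fx∈β , β⊆W))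
      (countable λ β → ∩-borel (cell-borel β) (constant-borel (∀ z → cell β z → W z)))
    network-measurable _ (compl b) = compl (network-measurable _ b)
    network-measurable _ (union b) = union (λ n → network-measurable _ (b n))
    network-measurable _ (resp (A⊆B , B⊆A) b) = resp (A⊆B , B⊆A) (network-measurable _ b)

  cylinder-borel : ∀ {I Y B : Set} (cell : B → Pred Y 0ℓ) (T : X → I → Y) →
                   (∀ i β → 𝓑 (λ x → cell β (T x i))) → ∀ l → 𝓑 (Cylinder cell l ∘ T)
  cylinder-borel cell T cell-borel []            = resp ((λ _ → []) , (λ _ → tt)) U-borel
  cylinder-borel cell T cell-borel ((i , β) ∷ l) = resp
    ((λ (a , as) → a ∷ as) , λ { (a ∷ as) → a , as })
    (∩-borel (cell-borel i β) (cylinder-borel cell T cell-borel l))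

-- Borel sets of the real line and of the extended values.

module Lines (em : ExcludedMiddle 0ℓ) (𝓡 : Reals) where
  open OrderedField em 𝓡
  open Values em 𝓡

  openℝ-U : openℝ U
  openℝ-U _ _ = 1# , 0<1 , λ _ _ _ → tt

  openℝ-below : ∀ c → openℝ (_< c)
  openℝ-below c r r<c = c + - r , x<y⇒0<y-x r<c ,
    λ s _ s<r+[c-r] → subst (s <_) (x+[y-x]≡y r c) s<r+[c-r]

  openℝ-above : ∀ c → openℝ (c <_)
  openℝ-above c r c<r = r + - c , x<y⇒0<y-x c<r ,
    λ s r-[r-c]<s _ → subst (_< s) (x-[x-y]≡y r c) r-[r-c]<s

  module _ where
    open BorelSets em openℝ (open′ openℝ-U)

    -- With a maximum m, D is the complement of the open ray above m. Without one, every point of D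
    -- is below a fraction in D, so D is a countable union of open rays; this includes the empty set
    -- and the whole line.
    downward-borel : ∀ {D} → (∀ {x y} → x ≤ y → D y → D x) → Borel openℝ D
    downward-borel {D} down with em {∃[ m ] D m × (∀ x → D x → x ≤ m)}
    ... | yes (m , Dm , D≤m) = resp
      ((λ m≮x → down (≮⇒≥ m≮x) Dm) , (λ Dx m<x → <⇒≱ m<x (D≤m _ Dx)))
      (compl (open′ (openℝ-above m)))
    ... | no no-maximum = resp
      ( (λ (q , Dq , x<q) → down (<⇒≤ x<q) Dq)
      , (λ {x} Dx →
          let larger : ∃[ y ] D y × x < y
              larger = decidable-stable em λ none → no-maximum
                (x , Dx , λ y Dy → ≮⇒≥ λ x<y → none (y , Dy , x<y))
              y , Dy , x<y = larger
              q , x<q , q<y = fraction-dense x<y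
          in q , down (<⇒≤ q<y) Dy , x<q))
      (countable-ℕ³ λ q →
        ∩-borel (constant-borel (D (fraction q))) (open′ (openℝ-below (fraction q))))

    upward-borel : ∀ {D} → (∀ {x y} → x ≤ y → D x → D y) → Borel openℝ D
    upward-borel up = resp ((λ ¬¬Dx → decidable-stable em ¬¬Dx) , (λ Dx ¬Dx → ¬Dx Dx))
      (compl (downward-borel λ x≤y ¬Dy Dx → ¬Dy (up x≤y Dx)))

    Convex : Pred ℝ 0ℓ → Set
    Convex C = ∀ {x y z} → C x → C z → x ≤ y → y ≤ z → C y

    -- Hence squaring, halving and, on either side of 0, inversion are Borel by monotonicity alone,
    -- with no appeal to continuity.
    convex-borel : ∀ {C} → Convex C → Borel openℝ C
    convex-borel {C} convex = resp
      ( (λ ((z , Cz , y≤z) , (x , Cx , x≤y)) → convex Cx Cz x≤y y≤z)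
      , (λ {y} Cy → (y , Cy , ≤-refl) , (y , Cy , ≤-refl)))
      (∩-borel {A = λ y → ∃[ z ] C z × y ≤ z} {B = λ y → ∃[ x ] C x × x ≤ y}
        (downward-borel λ { x≤y (z , Cz , y≤z) → z , Cz , ≤-trans x≤y y≤z })
        (upward-borel λ { y≤z (x , Cx , x≤y) → x , Cx , ≤-trans x≤y y≤z }))

  -- Induction on the generation of S. The complement in `ℝₑ` would also contain `err`, so it is cut
  -- back to the finite values.
  just-borel : ∀ {S} → Borel openℝ S → Borel openℝₑ (Any S)
  just-borel (open′ S-open) = open′ λ r Sr →
    let ε , 0<ε , ball⊆S = S-open r (Any.drop-just Sr)
    in ε , 0<ε , λ s l u → just (ball⊆S s l u)
  just-borel (compl {A} b) = resp (to , from)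
    (∩-borel (open′ λ r _ → 1# , 0<1 , λ _ _ _ → just tt) (compl (just-borel b)))
    where
    open BorelSets em openℝₑ (open′ openℝ-U)

    to : ∀ {u} → (Any U ∩ ∁ (Any A)) u → Any (∁ A) u
    to (just _ , ¬Au) = just (¬Au ∘ just)

    from : ∀ {u} → Any (∁ A) u → (Any U ∩ ∁ (Any A)) u
    from (just ¬Ax) = just tt , λ { (just Ax) → ¬Ax Ax }
  just-borel (union {A} b) = resp
    ((λ (n , a) → Any.map (n ,_) a) , λ { (just (n , a)) → n , just a })
    (union λ n → just-borel (b n))
  just-borel (resp (A⊆B , B⊆A) b) = resp (Any.map A⊆B , Any.map B⊆A) (just-borel b)

  -- The point `err` and the intervals [p, q). The second conjunct excludes `err`, which the first
  -- one admits.
  cellₑ : Maybe (Fraction × Fraction) → Pred ℝₑ 0ℓ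
  cellₑ nothing        u = ¬ Any U u
  cellₑ (just (p , q)) u = ¬ Any (_< fraction p) u × Any (_< fraction q) u

  openℝₑ-network : Network openℝₑ cellₑ
  openℝₑ-network {W} W-open {nothing} W-err = nothing , (λ ()) , err-only
    where
    err-only : ∀ u → ¬ Any U u → W u
    err-only nothing  _   = W-err
    err-only (just _) ¬Uu = contradiction (just tt) ¬Uu
  openℝₑ-network {W} W-open {just r} Wr =
    let ε , 0<ε , ball⊆W = W-open r Wr
        p , r-ε<p , p<r  = fraction-dense (x-ε<x 0<ε)
        q , r<q , q<r+ε  = fraction-dense (x<x+ε 0<ε)
        half-open⊆W : ∀ u → cellₑ (just (p , q)) u → W u
        half-open⊆W = λ { (just s) (s≮p , just s<q) →
          ball⊆W s (<-≤-trans r-ε<p (≮⇒≥ (s≮p ∘ just))) (<-trans s<q q<r+ε) }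
    in just (p , q) , ((λ { (just r<p) → <-irrefl (<-trans r<p p<r) }) , just r<q) , half-open⊆W

  cellₑ-borel : ∀ β → Borel openℝₑ (cellₑ β)
  cellₑ-borel nothing        = compl (just-borel (open′ openℝ-U))
  cellₑ-borel (just (p , q)) =
    ∩-borel (compl (just-borel (open′ (openℝ-below (fraction p)))))
            (just-borel (open′ (openℝ-below (fraction q))))
    where open BorelSets em openℝₑ (open′ openℝ-U)

  -- Measurability of extended arithmetic and of comparisons.

  module Measurability {ℓ : Level} {X : Set} (Open : Topology ℓ X) (U-borel : Borel Open U) where
    open BorelSets em Open U-borel

    Measurableₑ : (X → ℝₑ) → Set _
    Measurableₑ = Measurable Open openℝₑ

    -- Cells are Boolean combinations of the sets below c; by the Archimedean property, `err` is the
    -- one value below no natural number.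
    measurableₑ : ∀ {f} → (∀ c → 𝓑 (Any (_< c) ∘ f)) → Measurableₑ f
    measurableₑ {f} below =
      network-measurable openℝₑ-network
        (countable-Maybe (countable-Σ countable-ℕ³ λ _ → countable-ℕ³)) cell-borel
      where
      finite : ∀ {u} → Any U u → ∃[ n ] Any (_< fromℕ n) u
      finite {just x} (just _) = let n , x<n = archimedean x in n , just x<n

      cell-borel : ∀ β → 𝓑 (cellₑ β ∘ f)
      cell-borel nothing        = compl (resp
        ((λ (_ , a) → Any.map (λ _ → tt) a) , finite) (union λ n → below (fromℕ n)))
      cell-borel (just (p , q)) = ∩-borel (compl (below (fraction p))) (below (fraction q))

    preimage-borel : ∀ {f S} → Measurableₑ f → Borel openℝ S → 𝓑 (Any S ∘ f)
    preimage-borel f-measurable S-borel = f-measurable _ (just-borel S-borel)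

    below-borel : ∀ {f} → Measurableₑ f → ∀ c → 𝓑 (Any (_< c) ∘ f)
    below-borel f-measurable c = preimage-borel f-measurable (open′ (openℝ-below c))

    measurable-cong : ∀ {f g} → (∀ x → f x ≡ g x) → Measurableₑ f → Measurableₑ g
    measurable-cong f≗g f-measurable W W-borel = resp
      ( (λ {x} → subst W (f≗g x)) , (λ {x} → subst W (sym (f≗g x)))) (f-measurable W W-borel)

    -- The hypothesis is quasiconvexity of `h`, which holds for monotone functions of either
    -- direction and for the square.
    map-measurable : ∀ {f} (h : ℝ → ℝ) → (∀ c → Convex (λ x → h x < c)) →
                     Measurableₑ f → Measurableₑ (Maybe.map h ∘ f)
    map-measurable {f} h h-convex f-measurable = measurableₑ λ c → resp
      ((λ { {x} → to }) , (λ { {x} → from })) (preimage-borel f-measurable (convex-borel (h-convex c)))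
      where
      to : ∀ {c u} → Any (λ x → h x < c) u → Any (_< c) (Maybe.map h u)
      to (just hx<c) = just hx<c

      from : ∀ {c u} → Any (_< c) (Maybe.map h u) → Any (λ x → h x < c) u
      from {u = just _} (just hx<c) = just hx<c

    -- x + y < c exactly when some fraction separates x from c - y, which gives a countable union of
    -- rectangles.
    +-measurable : ∀ {f g} → Measurableₑ f → Measurableₑ g →
                   Measurableₑ (λ x → opₑ plus (f x) (g x))
    +-measurable {f} {g} f-measurable g-measurable = measurableₑ λ c → resp
      ((λ (q , u , v) → to u v) , from)
      (countable-ℕ³ λ q → ∩-borel (below-borel f-measurable (fraction q))
                                        (below-borel g-measurable (c + - fraction q)))
      where
      to : ∀ {c q u v} → Any (_< q) u → Any (_< c + - q) v → Any (_< c) (opₑ plus u v)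
      to {c} {q} (just {x} x<q) (just {y} y<c-q) =
        just (<-trans (+-monoˡ-< y x<q) (subst (_< c) (+-comm y q) (<-⇒+< y<c-q)))

      from : ∀ {c u v} → Any (_< c) (opₑ plus u v) →
             ∃[ q ] Any (_< fraction q) u × Any (_< c + - fraction q) v
      from {c} {just x} {just y} (just x+y<c) =
        let q , x<q , q<c-y = fraction-dense (+<⇒<- x+y<c)
        in q , just x<q , just (+<⇒<- (subst (_< c) (+-comm (fraction q) y) (<-⇒+< q<c-y)))

    neg-measurable : ∀ {f} → Measurableₑ f → Measurableₑ (negₑ ∘ f)
    neg-measurable = map-measurable -_ λ c -x<c _ x≤y _ → ≤-<-trans (neg-antitone x≤y) -x<c

    minus-measurable : ∀ {f g} → Measurableₑ f → Measurableₑ g →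
                       Measurableₑ (λ x → opₑ minus (f x) (g x))
    minus-measurable {f} {g} f-measurable g-measurable = measurable-cong
      (λ x → minus≡plus-neg (f x) (g x)) (+-measurable f-measurable (neg-measurable g-measurable))
      where
      minus≡plus-neg : ∀ u v → opₑ plus u (negₑ v) ≡ opₑ minus u v
      minus≡plus-neg nothing  _        = refl
      minus≡plus-neg (just _) nothing  = refl
      minus≡plus-neg (just _) (just _) = refl

    square : ℝ → ℝ
    square x = x * x

    square-measurable : ∀ {f} → Measurableₑ f → Measurableₑ (Maybe.map square ∘ f)
    square-measurable = map-measurable square convex
      where
      convex : ∀ c → Convex (λ x → square x < c)
      convex c {y = y} x²<c z²<c x≤y y≤z with ≤-total 0# y
      -- The sign of the middle point decides which endpoint has the larger square.
      ... | inj₁ 0≤y = ≤-<-trans (square-mono 0≤y y≤z) z²<c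
      ... | inj₂ y≤0 = ≤-<-trans (square-antitone x≤y y≤0) x²<c

    *-measurable : ∀ {f g} → Measurableₑ f → Measurableₑ g →
                   Measurableₑ (λ x → opₑ times (f x) (g x))
    *-measurable {f} {g} f-measurable g-measurable = measurable-cong
      (λ x → polarised (f x) (g x))
      (map-measurable (_* ½)
        (λ c _ z½<c _ y≤z → ≤-<-trans (*-monoˡ-≤ (<⇒≤ (⁻¹-positive 0<1+1)) y≤z) z½<c)
        (minus-measurable
          (square-measurable (+-measurable f-measurable g-measurable))
          (+-measurable (square-measurable f-measurable) (square-measurable g-measurable))))
      where
      polarised : ∀ u v →
        Maybe.map (_* ½) (opₑ minus (Maybe.map square (opₑ plus u v))
                                    (opₑ plus (Maybe.map square u) (Maybe.map square v)))
        ≡ opₑ times u v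
      polarised nothing  _        = refl
      polarised (just _) nothing  = refl
      polarised (just x) (just y) = cong just (polarisation x y)

    reciprocal : ℝₑ → ℝₑ
    reciprocal nothing  = err
    reciprocal (just y) = if does (em {y ≡ 0#}) then err else just (y ⁻¹)

    -- Inversion is antitone on each side of 0 but not across it, hence two convex pieces. The value
    -- 0 goes to `err` and so lies in no sublevel set.
    reciprocal-measurable : ∀ {f} → Measurableₑ f → Measurableₑ (reciprocal ∘ f)
    reciprocal-measurable {f} f-measurable = measurableₑ λ c → resp
      ((λ { {x} → to }) , (λ { {x} → from }))
      (∪-borel (preimage-borel f-measurable (convex-borel (positive-convex c)))
               (preimage-borel f-measurable (convex-borel (negative-convex c))))
      where
      Positive Negative : ℝ → Pred ℝ 0ℓ
      Positive c y = 0# < y × y ⁻¹ < c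
      Negative c y = y < 0# × y ⁻¹ < c

      positive-convex : ∀ c → Convex (Positive c)
      positive-convex c (0<x , x⁻¹<c) _ x≤y _ =
        let 0<y = <-≤-trans 0<x x≤y in
        0<y , ≤-<-trans (⁻¹-antitone (0<⇒≢0 0<x) (0<⇒≢0 0<y)
          (*-nonNegative (<⇒≤ (⁻¹-positive 0<x)) (<⇒≤ (⁻¹-positive 0<y))) x≤y) x⁻¹<c

      negative-convex : ∀ c → Convex (Negative c)
      negative-convex c (x<0 , x⁻¹<c) (z<0 , _) x≤y y≤z =
        let y<0 = ≤-<-trans y≤z z<0 in
        y<0 , ≤-<-trans (⁻¹-antitone (proj₂ x<0) (proj₂ y<0)
          (*-nonPositive (⁻¹-nonPositive x<0) (⁻¹-nonPositive y<0)) x≤y) x⁻¹<c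

      to : ∀ {c u} → Any (Positive c) u ⊎ Any (Negative c) u → Any (_< c) (reciprocal u)
      to (inj₁ (just {y} (0<y , y⁻¹<c))) with em {y ≡ 0#}
      ... | yes y≡0 = contradiction y≡0 (0<⇒≢0 0<y)
      ... | no  _   = just y⁻¹<c
      to (inj₂ (just {y} (y<0 , y⁻¹<c))) with em {y ≡ 0#}
      ... | yes y≡0 = contradiction y≡0 (proj₂ y<0)
      ... | no  _   = just y⁻¹<c

      from : ∀ {c u} → Any (_< c) (reciprocal u) → Any (Positive c) u ⊎ Any (Negative c) u
      from {u = just y} a with em {y ≡ 0#}
      from {u = just y} (just y⁻¹<c) | no y≢0 with ≤-total 0# y
      ... | inj₁ 0≤y = inj₁ (just ((0≤y , y≢0 ∘ sym) , y⁻¹<c))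
      ... | inj₂ y≤0 = inj₂ (just ((y≤0 , y≢0) , y⁻¹<c))

    over-measurable : ∀ {f g} → Measurableₑ f → Measurableₑ g →
                      Measurableₑ (λ x → opₑ over (f x) (g x))
    over-measurable {f} {g} f-measurable g-measurable = measurable-cong
      (λ x → times-reciprocal (f x) (g x))
      (*-measurable f-measurable (reciprocal-measurable g-measurable))
      where
      times-reciprocal : ∀ u v → opₑ times u (reciprocal v) ≡ opₑ over u v
      times-reciprocal nothing  _        = refl
      times-reciprocal (just _) nothing  = refl
      times-reciprocal (just _) (just y) with em {y ≡ 0#}
      ... | yes _ = refl
      ... | no  _ = refl

    op-measurable : ∀ {f g} ◇ → Measurableₑ f → Measurableₑ g →
                    Measurableₑ (λ x → opₑ ◇ (f x) (g x))
    op-measurable plus  = +-measurable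
    op-measurable minus = minus-measurable
    op-measurable times = *-measurable
    op-measurable over  = over-measurable

    -- Fails as soon as one value is `err`, whereas `compare` then admits both outcomes; tests are
    -- recovered from it by complementing.
    Both : (ℝ → ℝ → Set) → ℝₑ → ℝₑ → Set
    Both _~_ u v = Any (λ x → Any (x ~_) v) u

    module _ {f g : X → ℝₑ} (f-measurable : Measurableₑ f) (g-measurable : Measurableₑ g) where

      -- The negated relation is the complement taken within the pairs of finite values.
      both-∁-borel : ∀ {_~_} → 𝓑 (λ x → Both _~_ (f x) (g x)) →
                     𝓑 (λ x → Both (λ a b → ¬ a ~ b) (f x) (g x))
      both-∁-borel {_~_} b = resp
        ((λ (Uf , Ug , ¬b) → to Uf Ug ¬b) , (λ { {x} → from }))
        (∩-borel (preimage-borel f-measurable (open′ openℝ-U))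
          (∩-borel (preimage-borel g-measurable (open′ openℝ-U)) (compl b)))
        where
        to : ∀ {u v} → Any U u → Any U v → ¬ Both _~_ u v → Both (λ a b → ¬ a ~ b) u v
        to (just _) (just _) ¬b = just (just λ x~y → ¬b (just (just x~y)))

        from : ∀ {u v} → Both (λ a b → ¬ a ~ b) u v → Any U u × Any U v × ¬ Both _~_ u v
        from (just (just x≁y)) = just tt , just tt , λ { (just (just x~y)) → x≁y x~y }

      both-<-borel : 𝓑 (λ x → Both _<_ (f x) (g x))
      both-<-borel = resp ((λ (_ , u , v) → to u v) , (λ { {x} → from }))
        (countable-ℕ³ λ q → ∩-borel
          (below-borel f-measurable (fraction q))
          (preimage-borel g-measurable (open′ (openℝ-above (fraction q)))))
        where
        to : ∀ {q u v} → Any (_< q) u → Any (q <_) v → Both _<_ u v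
        to (just x<q) (just q<y) = just (just (<-trans x<q q<y))

        from : ∀ {u v} → Both _<_ u v → ∃[ q ] Any (_< fraction q) u × Any (fraction q <_) v
        from (just (just x<y)) =
          let q , x<q , q<y = fraction-dense x<y in q , just x<q , just q<y

    both-≤-borel : ∀ {f g} → Measurableₑ f → Measurableₑ g → 𝓑 (λ x → Both _≤_ (f x) (g x))
    both-≤-borel f-measurable g-measurable = resp ((λ { {x} → to }) , (λ { {x} → from }))
      (both-∁-borel g-measurable f-measurable (both-<-borel g-measurable f-measurable))
      where
      to : ∀ {u v} → Both (λ b a → ¬ b < a) v u → Both _≤_ u v
      to (just (just b≮a)) = just (just (≮⇒≥ b≮a))

      from : ∀ {u v} → Both _≤_ u v → Both (λ b a → ¬ b < a) v u
      from (just (just a≤b)) = just (just λ b<a → <⇒≱ b<a a≤b)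

    both-≡-borel : ∀ {f g} → Measurableₑ f → Measurableₑ g → 𝓑 (λ x → Both _≡_ (f x) (g x))
    both-≡-borel f-measurable g-measurable = resp ((λ (b , c) → to b c) , (λ { {x} → from }))
      (∩-borel (both-≤-borel f-measurable g-measurable) (both-≤-borel g-measurable f-measurable))
      where
      to : ∀ {u v} → Both _≤_ u v → Both _≤_ v u → Both _≡_ u v
      to (just (just a≤b)) (just (just b≤a)) = just (just (≤-antisym a≤b b≤a))

      from : ∀ {u v} → Both _≡_ u v → Both _≤_ u v × Both _≤_ v u
      from (just (just refl)) = just (just ≤-refl) , just (just ≤-refl)

    both-borel : ∀ R {f g} → Measurableₑ f → Measurableₑ g → 𝓑 (λ x → Both ⟪ R ⟫ (f x) (g x))
    both-borel le = both-≤-borel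
    both-borel lt = both-<-borel
    both-borel eq = both-≡-borel
    both-borel ne f-measurable g-measurable =
      both-∁-borel f-measurable g-measurable (both-≡-borel f-measurable g-measurable)

-- Suprema in [0,∞] and measurability of functions into it.

module Answers (em : ExcludedMiddle 0ℓ) (𝓡 : Reals) where
  open OrderedField em 𝓡
  open Values em 𝓡
  open Supremum (λ (r s : ℝ≥0) → value r ≤ value s) using ([_]; _≤⊤⁺; ≤⁺-isPartialOrder-≡)

  value-injective : ∀ {r s : ℝ≥0} → value r ≡ value s → r ≡ s
  value-injective {_ , _} {_ , _} refl = refl

  nonNegative : ∀ (r : ℝ≥0) → 0# ≤ value r
  nonNegative (_ , [ 0≤r ]) = recompute em 0≤r

  answers : Poset 0ℓ 0ℓ 0ℓ
  answers = record
    { isPartialOrder = ≤⁺-isPartialOrder-≡ record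
      { isPreorder = record
        { isEquivalence = isEquivalence
        ; reflexive     = ≤-reflexive ∘ cong value
        ; trans         = ≤-trans
        }
      ; antisym = λ r≤s s≤r → value-injective (≤-antisym r≤s s≤r)
      }
    }

  open Poset answers public using () renaming
    (refl to ≤ₐ-refl; reflexive to ≤ₐ-reflexive; trans to ≤ₐ-trans; antisym to ≤ₐ-antisym)
  open PosetReasoning answers

  0ₐ-minimum : ∀ a → 0ₐ ≤ₐ a
  0ₐ-minimum [ r ] = [ nonNegative r ]
  0ₐ-minimum ∞     = 0ₐ ≤⊤⁺

  module _ {I : Set} where

    ⨆-upper : ∀ (a : I → Ans) i → a i ≤ₐ ⨆ a
    ⨆-upper a i with em {FiniteBound a}
    ... | no  _       = a i ≤⊤⁺
    ... | yes (b , a≤b) with a i in aᵢ≡x | a≤b i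
    ...   | [ x , p ] | _ =
      [ proj₁ (proj₂ (complete (range₀ a) (0# , inj₁ refl) (range₀-bounded a (b , a≤b))))
          (inj₂ (i , p , aᵢ≡x)) ]

    ⨆-least : ∀ {a : I → Ans} {b} → (∀ i → a i ≤ₐ b) → ⨆ a ≤ₐ b
    ⨆-least {a} {∞}     _   = _ ≤⊤⁺
    ⨆-least {a} {[ b ]} a≤b with em {FiniteBound a}
    ... | no unbounded = contradiction (b , a≤b) unbounded
    ... | yes bounded  =
      [ proj₂ (proj₂ (complete (range₀ a) (0# , inj₁ refl) (range₀-bounded a bounded))) bound ]
      where
      bound : UpperBound (range₀ a) (value b)
      bound (inj₁ refl) = nonNegative b
      bound (inj₂ (i , _ , aᵢ≡x)) with a i | a≤b i
      bound (inj₂ (i , _ , refl)) | _ | [ x≤b ] = x≤b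

    ⨆-mono : ∀ {a b : I → Ans} → (∀ i → a i ≤ₐ b i) → ⨆ a ≤ₐ ⨆ b
    ⨆-mono {b = b} a≤b = ⨆-least λ i → ≤ₐ-trans (a≤b i) (⨆-upper b i)

    ⨆-cong : ∀ {a b : I → Ans} → (∀ i → a i ≡ b i) → ⨆ a ≡ ⨆ b
    ⨆-cong a≗b = ≤ₐ-antisym (⨆-mono λ i → ≤ₐ-reflexive (a≗b i))
                            (⨆-mono λ i → ≤ₐ-reflexive (sym (a≗b i)))

  ⨆-swap : ∀ {I J : Set} (a : I → J → Ans) →
           ⨆ (λ i → ⨆ (λ j → a i j)) ≡ ⨆ (λ j → ⨆ (λ i → a i j))
  ⨆-swap a = ≤ₐ-antisym (half a) (half λ j i → a i j)
    where
    half : ∀ {I J : Set} (a : I → J → Ans) →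
           ⨆ (λ i → ⨆ (λ j → a i j)) ≤ₐ ⨆ (λ j → ⨆ (λ i → a i j))
    half a = ⨆-least λ i → ⨆-mono λ j → ⨆-upper (λ k → a k j) i

  +ₐ-mono : ∀ {a b c d} → a ≤ₐ b → c ≤ₐ d → a +ₐ c ≤ₐ b +ₐ d
  +ₐ-mono [ a≤b ]      [ c≤d ]  = [ +-mono-≤ a≤b c≤d ]
  +ₐ-mono [ _ ]        (_ ≤⊤⁺)  = _ ≤⊤⁺
  +ₐ-mono (_ ≤⊤⁺)      _        = _ ≤⊤⁺

  -- Only an inequality, since the two families may approach their suprema at different indices.
  -- This is why tests with two possible outcomes give upper previsions rather than linear ones.
  ⨆-subadditive : ∀ {I : Set} (a b : I → Ans) → ⨆ (λ i → a i +ₐ b i) ≤ₐ ⨆ a +ₐ ⨆ b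
  ⨆-subadditive a b = ⨆-least λ i → +ₐ-mono (⨆-upper a i) (⨆-upper b i)

  *ₐ-zero : ∀ {α} → value α ≡ 0# → ∀ a → [ α ] *ₐ a ≡ 0ₐ
  *ₐ-zero α≡0 [ r ] = cong [_] (value-injective (trans (cong (_* value r) α≡0) (zeroˡ _)))
  *ₐ-zero {α} α≡0 ∞ with em {value α ≡ 0#}
  ... | yes _   = refl
  ... | no  α≢0 = contradiction α≡0 α≢0

  *ₐ-∞ : ∀ {α} → value α ≢ 0# → [ α ] *ₐ ∞ ≡ ∞
  *ₐ-∞ {α} α≢0 with em {value α ≡ 0#}
  ... | yes α≡0 = contradiction α≡0 α≢0
  ... | no  _   = refl

  *ₐ-mono : ∀ α {a b} → a ≤ₐ b → [ α ] *ₐ a ≤ₐ [ α ] *ₐ b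
  *ₐ-mono α {[ r ]} {[ s ]} [ r≤s ] = [ subst₂ _≤_ (*-comm (value r) (value α)) (*-comm (value s) (value α))
    (*-monoˡ-≤ (nonNegative α) r≤s) ]
  *ₐ-mono α {a} {∞} (_ ≤⊤⁺) with em {value α ≡ 0#}
  ... | yes α≡0 = ≤ₐ-reflexive (*ₐ-zero {α} α≡0 a)
  ... | no  _   = _ ≤⊤⁺

  *ₐ-cancel : ∀ α β → value β * value α ≡ 1# → ∀ a → [ β ] *ₐ ([ α ] *ₐ a) ≡ a
  *ₐ-cancel α β βα≡1 [ r ] = cong [_] (value-injective
    (trans (sym (*-assoc _ _ _)) (trans (cong (_* value r) βα≡1) (*-identityˡ _))))
  *ₐ-cancel α β βα≡1 ∞ = trans (cong ([ β ] *ₐ_) (*ₐ-∞ {α} α≢0)) (*ₐ-∞ {β} β≢0)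
    where
    α≢0 : value α ≢ 0#
    α≢0 α≡0 = 0≢1 (trans (sym (zeroʳ (value β))) (trans (cong (value β *_) (sym α≡0)) βα≡1))

    β≢0 : value β ≢ 0#
    β≢0 β≡0 = 0≢1 (trans (sym (zeroˡ (value α))) (trans (cong (_* value α) (sym β≡0)) βα≡1))

  -- For α = 0 both sides vanish, by the convention on 0 times ∞. Otherwise scaling by α has the
  -- monotone inverse scaling by β = 1 / α, and an order isomorphism preserves suprema.
  *ₐ-⨆ : ∀ {I : Set} α (a : I → Ans) → ⨆ (λ i → [ α ] *ₐ a i) ≡ [ α ] *ₐ ⨆ a
  *ₐ-⨆ α a with em {value α ≡ 0#}
  ... | yes α≡0 = trans
    (≤ₐ-antisym (⨆-least λ i → ≤ₐ-reflexive (*ₐ-zero {α} α≡0 (a i))) (0ₐ-minimum _))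
    (sym (*ₐ-zero {α} α≡0 (⨆ a)))
  ... | no  α≢0 = ≤ₐ-antisym (⨆-least λ i → *ₐ-mono α (⨆-upper a i)) (begin
    [ α ] *ₐ ⨆ a              ≤⟨ *ₐ-mono α (⨆-least λ i → begin
                                   a i                          ≡⟨ sym (*ₐ-cancel α β βα≡1 (a i)) ⟩
                                   [ β ] *ₐ ([ α ] *ₐ a i)      ≤⟨ *ₐ-mono β (⨆-upper αa i) ⟩
                                   [ β ] *ₐ ⨆ αa                ∎) ⟩
    [ α ] *ₐ ([ β ] *ₐ ⨆ αa)  ≡⟨ *ₐ-cancel β α (⁻¹-inverseʳ α≢0) (⨆ αa) ⟩
    ⨆ αa                      ∎)
    where
    αa = λ i → [ α ] *ₐ a i

    β : ℝ≥0
    β = value α ⁻¹ , [ <⇒≤ (⁻¹-positive (nonNegative α , α≢0 ∘ sym)) ]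

    βα≡1 : value β * value α ≡ 1#
    βα≡1 = trans (*-comm _ _) (⁻¹-inverseʳ α≢0)

  infix 4 _≤ᵣ_

  -- Takes any real threshold, because fractions bounding a cell may be negative and then are not
  -- answers.
  _≤ᵣ_ : Ans → ℝ → Set
  [ r ] ≤ᵣ c = value r ≤ c
  ∞     ≤ᵣ c = ⊥

  -- The intervals (p, q] and the rays (p, ∞], closed on the right to match sublevel sets of the
  -- form f ≤ c.
  cellₐ : Fraction × Maybe Fraction → Pred Ans 0ℓ
  cellₐ (p , just q)  a = ¬ a ≤ᵣ fraction p × a ≤ᵣ fraction q
  cellₐ (p , nothing) a = ¬ a ≤ᵣ fraction p

  openAns-network : Network openAns cellₐ
  openAns-network {W} (W-open , _) {[ r ]} Wr =
    let ε , 0<ε , ball⊆W = W-open r Wr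
        p , r-ε<p , p<r  = fraction-dense (x-ε<x 0<ε)
        q , r<q , q<r+ε  = fraction-dense (x<x+ε 0<ε)
        half-open⊆W : ∀ a → cellₐ (p , just q) a → W a
        half-open⊆W = λ { [ s ] (s≰p , s≤q) →
          ball⊆W s (<-trans r-ε<p (≰⇒> s≰p)) (≤-<-trans s≤q q<r+ε) }
    in (p , just q) , (<⇒≱ p<r , <⇒≤ r<q) , half-open⊆W
  openAns-network {W} (_ , W-open) {∞} W∞ =
    let m , ray⊆W   = W-open W∞
        -- Any fraction above m serves; the width 1 is arbitrary.
        p , m<p , _ = fraction-dense (x<x+ε {m} 0<1)
        ray : ∀ a → cellₐ (p , nothing) a → W a
        ray = λ { [ s ] s≰p → ray⊆W s (<-trans m<p (≰⇒> s≰p)) ; ∞ _ → W∞ }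
    in (p , nothing) , (λ ()) , ray

  openAns-above : ∀ c → openAns (λ a → ¬ a ≤ₐ [ c ])
  openAns-above c =
    ( λ r r≰c → value r + - value c , x<y⇒0<y-x (≰⇒> (r≰c ∘ [_])) ,
        λ s r-[r-c]<s _ → above (subst (_< value s) (x-[x-y]≡y (value r) (value c)) r-[r-c]<s))
    , λ _ → value c , λ s → above
    where
    above : ∀ {s} → value c < value s → ¬ [ s ] ≤ₐ [ c ]
    above c<s [ s≤c ] = <⇒≱ c<s s≤c

  module AnswerMeasurability {ℓ : Level} {X : Set} (Open : Topology ℓ X) (U-borel : Borel Open U) where
    open BorelSets em Open U-borel

    sublevel-borel : ∀ {f} → 𝓜₊ Open f → ∀ c → 𝓑 (λ x → f x ≤ₐ [ c ])
    sublevel-borel f-measurable c = resp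
      ((λ ¬f≰c → decidable-stable em ¬f≰c) , (λ f≤c f≰c → f≰c f≤c))
      (compl (f-measurable (λ a → ¬ a ≤ₐ [ c ]) (open′ (openAns-above c))))

    𝓜₊-sublevel : ∀ {f} → (∀ c → 𝓑 (λ x → f x ≤ₐ [ c ])) → 𝓜₊ Open f
    𝓜₊-sublevel {f} f-sublevel =
      network-measurable openAns-network (countable-Σ countable-ℕ³ λ _ → countable-Maybe countable-ℕ³)
        cell-borel
      where
      to : ∀ {c a} → a ≤ₐ [ c ] → a ≤ᵣ value c
      to [ r≤c ] = r≤c

      from : ∀ {c} a → a ≤ᵣ value c → a ≤ₐ [ c ]
      from [ _ ] r≤c = [ r≤c ]

      empty : ∀ {c} a → ¬ 0# ≤ c → ¬ a ≤ᵣ c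
      empty [ r ] 0≰c r≤c = 0≰c (≤-trans (nonNegative r) r≤c)

      ≤ᵣ-borel : ∀ c → 𝓑 (λ x → f x ≤ᵣ c)
      ≤ᵣ-borel c with em {0# ≤ c}
      ... | yes 0≤c = resp (to , (λ {x} → from {c , [ 0≤c ]} (f x))) (f-sublevel (c , [ 0≤c ]))
      -- Answers are nonnegative, so a negative threshold cuts out the empty set.
      ... | no  0≰c = resp ((λ ()) , (λ {x} → empty (f x) 0≰c)) (constant-borel ⊥)

      cell-borel : ∀ β → 𝓑 (cellₐ β ∘ f)
      cell-borel (p , just q)  = ∩-borel (compl (≤ᵣ-borel (fraction p))) (≤ᵣ-borel (fraction q))
      cell-borel (p , nothing) = compl (≤ᵣ-borel (fraction p))

    -- The index type may vary with the point, as the set of outcomes of a test does; so the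
    -- intersection is left as a hypothesis instead of being formed over a fixed type.
    ⨆-sublevel : ∀ {I : X → Set} (a : ∀ x → I x → Ans) c →
                 𝓑 (λ x → ∀ i → a x i ≤ₐ [ c ]) → 𝓑 (λ x → ⨆ (a x) ≤ₐ [ c ])
    ⨆-sublevel a c = resp
      ((λ a≤c → ⨆-least a≤c) , (λ {x} ⨆a≤c i → ≤ₐ-trans (⨆-upper (a x) i) ⨆a≤c))

    ⨆-measurable : ∀ {f : ℕ → X → Ans} → (∀ n → 𝓜₊ Open (f n)) → 𝓜₊ Open (λ x → ⨆ (λ n → f n x))
    ⨆-measurable f-measurable = 𝓜₊-sublevel λ c →
      ⨆-sublevel _ c (⋂-borel union λ n → sublevel-borel (f-measurable n) c)

-- Measurability of expressions, updates and tests.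

module Programs (em : ExcludedMiddle 0ℓ) (𝓡 : Reals) (𝓕 : Values.FloatingPoint em 𝓡)
                (𝒱 : Set) (𝒱-countable : 𝒱 ↣ ℕ) where
  open OrderedField em 𝓡
  open Lines em 𝓡
  open Values em 𝓡
  open Answers em 𝓡
  open FloatingPoint 𝓕
  open Syntax 𝒱
  open Semantics em 𝓡 𝓕 𝒱

  openVal-U : ∀ ⋆ → openVal ⋆ U
  openVal-U real  = openℝ-U
  openVal-U float = tt

  openEnv-U : ∀ ⋆ → openEnv ⋆ U
  openEnv-U ⋆ _ _ = [] , (λ _ → U) , (λ _ → openVal-U ⋆) , (λ ()) , λ _ _ → tt

  Index : Mode → Set
  Index real  = Maybe (Fraction × Fraction)
  Index float = 𝔽ₑ

  cell : ∀ ⋆ → Index ⋆ → Pred (Val ⋆) 0ℓ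
  cell real  = cellₑ
  cell float = _≡_

  cell-borel : ∀ ⋆ β → Borel (openVal ⋆) (cell ⋆ β)
  cell-borel real  = cellₑ-borel
  cell-borel float = λ _ → open′ tt

  openVal-network : ∀ ⋆ → Network (openVal ⋆) (cell ⋆)
  openVal-network real              = openℝₑ-network
  openVal-network float _ {v} Wv = v , refl , λ { _ refl → Wv }

  -- Membership is stored irrelevantly; excluded middle, read as a decision, returns a usable proof
  -- from which a position can be extracted.
  float∈floats : ∀ (f : 𝔽) → value f ∈ floats
  float∈floats (_ , [ f∈floats ]) = recompute em f∈floats

  float-index : 𝔽 → ℕ
  float-index f = toℕ (index (float∈floats f))

  -- Looking up the position gives back the value, so equal positions force equal floats even if the
  -- list has repetitions.
  float-index-injective : Injective _≡_ _≡_ float-index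
  float-index-injective {f} {g} i≡j = value-injective′
    (trans (lookup-index (float∈floats f))
      (trans (cong (lookup floats) (toℕ-injective i≡j)) (sym (lookup-index (float∈floats g)))))
    where
    value-injective′ : ∀ {f g : 𝔽} → value f ≡ value g → f ≡ g
    value-injective′ {_ , _} {_ , _} refl = refl

  module At (⋆ : Mode) where
    open BorelSets em (openEnv ⋆) (open′ (openEnv-U ⋆)) public
    open Measurability (openEnv ⋆) (open′ (openEnv-U ⋆)) public
    open AnswerMeasurability (openEnv ⋆) (open′ (openEnv-U ⋆)) public

  countable-𝒱 : ∀ ⋆ → At.Countable ⋆ 𝒱
  countable-𝒱 ⋆ =
    At.countable-injection ⋆ (Injection.to 𝒱-countable) (Injection.injective 𝒱-countable)

  countable-Index : ∀ ⋆ → At.Countable ⋆ (Index ⋆)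
  countable-Index real  = countable-Maybe (countable-Σ countable-ℕ³ λ _ → countable-ℕ³)
    where open At real
  countable-Index float = countable-Maybe (countable-injection float-index float-index-injective)
    where open At float

  -- The preimage of an open set is a cylinder constraining the single coordinate `x`.
  variable-measurable : ∀ ⋆ x → Measurable (openEnv ⋆) (openVal ⋆) (λ ρ → ρ x)
  variable-measurable ⋆ x _ (open′ {O} O-open) = open′ λ ρ Oρx →
    x ∷ [] , (λ _ → O) , (λ _ → O-open) , (λ { (here refl) → Oρx }) , λ _ O-at → O-at (here refl)
  variable-measurable ⋆ x _ (compl b)  = compl (variable-measurable ⋆ x _ b)
  variable-measurable ⋆ x _ (union b)  = union λ n → variable-measurable ⋆ x _ (b n)
  variable-measurable ⋆ x _ (resp (A⊆B , B⊆A) b) =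
    resp (A⊆B , B⊆A) (variable-measurable ⋆ x _ b)

  toℝₑ-measurable : ∀ ⋆ {v : Env ⋆ → Val ⋆} → Measurable (openEnv ⋆) (openVal ⋆) v →
                    Measurable (openEnv ⋆) openℝₑ (toℝₑ ⋆ ∘ v)
  toℝₑ-measurable real  v-measurable     = v-measurable
  -- Every set of floating-point values is open, in particular the preimage under `inj`.
  toℝₑ-measurable float v-measurable W _ = v-measurable (inj ⊢ W) (open′ tt)

  proj-∘-measurable : {g : Env float → ℝₑ} → Measurable (openEnv float) openℝₑ g →
                      Measurable (openEnv float) discrete (proj ∘ g)
  proj-∘-measurable g-measurable W W-borel = g-measurable (proj ⊢ W) (proj-measurable W W-borel)

  module _ where
    open At real

    real-expr-measurable : ∀ e → Measurableₑ ⟦ e ⟧ᵣ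
    real-expr-measurable (const a)     = constant-measurable (just (fromℚ a))
    real-expr-measurable (var x)       = variable-measurable real x
    real-expr-measurable (neg e)       = neg-measurable (real-expr-measurable e)
    real-expr-measurable (bin ◇ e₁ e₂) =
      op-measurable ◇ (real-expr-measurable e₁) (real-expr-measurable e₂)

  module _ where
    open At float

    float-expr-measurable : ∀ e → Measurable (openEnv float) discrete ⟦ e ⟧f
    float-expr-measurable (const a)     = constant-measurable (proj (just (fromℚ a)))
    float-expr-measurable (var x)       = variable-measurable float x
    float-expr-measurable (neg e)       =
      proj-∘-measurable (neg-measurable (toℝₑ-measurable float (float-expr-measurable e)))
    float-expr-measurable (bin ◇ e₁ e₂) = proj-∘-measurable
      (op-measurable ◇ (toℝₑ-measurable float (float-expr-measurable e₁))
                       (toℝₑ-measurable float (float-expr-measurable e₂)))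

  expr-measurable : ∀ ⋆ e → Measurable (openEnv ⋆) (openVal ⋆) (⟦ e ⟧ ⋆)
  expr-measurable real  = real-expr-measurable
  expr-measurable float = float-expr-measurable

  module _ (⋆ : Mode) where
    open At ⋆

    update-measurable : ∀ x e →
      Measurable (openEnv ⋆) (openEnv ⋆) (λ ρ → _[_↦_] {⋆} ρ x (⟦ e ⟧ ⋆ ρ))
    update-measurable x e = network-measurable (product-network (openVal-network ⋆))
      (countable-List (countable-Σ (countable-𝒱 ⋆) λ _ → countable-Index ⋆))
      (cylinder-borel (cell ⋆) (λ ρ → _[_↦_] {⋆} ρ x (⟦ e ⟧ ⋆ ρ))
        λ y β → coordinate y (cell ⋆ β) (cell-borel ⋆ β))
      where
      coordinate : ∀ y →
        Measurable (openEnv ⋆) (openVal ⋆) (λ ρ → (_[_↦_] {⋆} ρ x (⟦ e ⟧ ⋆ ρ)) y)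
      -- Whether y is x does not depend on ρ, so each coordinate of the update is globally either
      -- `⟦ e ⟧` or a projection.
      coordinate y with em {y ≡ x}
      ... | yes _ = expr-measurable ⋆ e
      ... | no  _ = variable-measurable ⋆ y

    -- An outcome is possible unless both values are finite and the relation dictates the other
    -- outcome. Taking this complement accounts for `err` automatically.
    compare-borel : ∀ R {f g} → Measurableₑ f → Measurableₑ g →
                    ∀ b → 𝓑 (λ x → compare R (f x) (g x) b)
    compare-borel R {f} {g} f-measurable g-measurable true = resp
      ((λ {x} → to (f x) (g x)) , (λ {x} → from (f x) (g x)))
      (compl (both-∁-borel f-measurable g-measurable (both-borel R f-measurable g-measurable)))
      where
      to : ∀ u v → ¬ Both (λ a b → ¬ ⟪ R ⟫ a b) u v → compare R u v true
      to nothing  _        _ = tt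
      to (just _) nothing  _ = tt
      to (just x) (just y) ¬b with em {⟪ R ⟫ x y}
      ... | yes _   = refl
      ... | no  x≁y = contradiction (just (just x≁y)) ¬b

      from : ∀ u v → compare R u v true → ¬ Both (λ a b → ¬ ⟪ R ⟫ a b) u v
      -- If the relation failed, c would be a proof that `false` equals `true`.
      from (just x) (just y) c (just (just x≁y)) with yes x~y ← em {⟪ R ⟫ x y} = x≁y x~y
    compare-borel R {f} {g} f-measurable g-measurable false = resp
      ((λ {x} → to (f x) (g x)) , (λ {x} → from (f x) (g x)))
      (compl (both-borel R f-measurable g-measurable))
      where
      to : ∀ u v → ¬ Both ⟪ R ⟫ u v → compare R u v false
      to nothing  _        _ = tt
      to (just _) nothing  _ = tt
      to (just x) (just y) ¬b with em {⟪ R ⟫ x y}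
      ... | yes x~y = contradiction (just (just x~y)) ¬b
      ... | no  _   = refl

      from : ∀ u v → compare R u v false → ¬ Both ⟪ R ⟫ u v
      from (just x) (just y) c (just (just x~y)) with no x≁y ← em {⟪ R ⟫ x y} = x≁y x~y

    test-borel : ∀ t b → 𝓑 (λ ρ → ⟦ t ⟧ᵗ ⋆ ρ b)
    test-borel (cmp R e₁ e₂) = compare-borel R (toℝₑ-measurable ⋆ (expr-measurable ⋆ e₁))
                                               (toℝₑ-measurable ⋆ (expr-measurable ⋆ e₂))
    test-borel (! t) b = resp
      ( (λ p → not b , p , sym (not-involutive b))
      , (λ { {ρ} (v , p , refl) → subst (⟦ t ⟧ᵗ ⋆ ρ) (sym (not-involutive v)) p }))
      (test-borel t (not b))

    -- The supremum is at most c iff each possible outcome has its continuation at most c: two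
    -- implications between Borel sets.
    branch-measurable : ∀ t {κ₁ κ₀} → 𝓜₊ (openEnv ⋆) κ₁ → 𝓜₊ (openEnv ⋆) κ₀ →
                        𝓜₊ (openEnv ⋆) (branch ⋆ t κ₁ κ₀)
    branch-measurable t {κ₁} {κ₀} κ₁-measurable κ₀-measurable = 𝓜₊-sublevel λ c →
      ⨆-sublevel _ c (resp
        ( (λ (κ₁≤c , κ₀≤c) → λ { (true , p) → κ₁≤c p ; (false , p) → κ₀≤c p })
        , (λ κ≤c → (λ p → κ≤c (true , p)) , (λ p → κ≤c (false , p))))
        (∩-borel (⇒-borel (test-borel t true) (sublevel-borel κ₁-measurable c))
                 (⇒-borel (test-borel t false) (sublevel-borel κ₀-measurable c))))

    -- Closure properties of the class of continuation transformers.

    record Regular (F : Cont ⋆ → Cont ⋆) : Set (lsuc 0ℓ) where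
      field
        closed      : ∀ κ → 𝓜₊ (openEnv ⋆) κ → 𝓜₊ (openEnv ⋆) (F κ)
        homogeneous : ∀ α κ ρ → F (λ σ → [ α ] *ₐ κ σ) ρ ≡ [ α ] *ₐ F κ ρ
        monotonic   : ∀ {κ κ′} → (∀ ρ → κ ρ ≤ₐ κ′ ρ) → ∀ ρ → F κ ρ ≤ₐ F κ′ ρ
        upper       : ∀ κ κ′ ρ → F (λ σ → κ σ +ₐ κ′ σ) ρ ≤ₐ F κ ρ +ₐ F κ′ ρ
        continuous  : ∀ (κ : ℕ → Cont ⋆) → (∀ n ρ → κ n ρ ≤ₐ κ (suc n) ρ) →
                      ∀ ρ → F (λ σ → ⨆ (λ n → κ n σ)) ρ ≡ ⨆ (λ n → F (κ n) ρ)

      -- Stands in for function extensionality: pointwise equal continuations lie below each other,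
      -- and monotonicity with antisymmetry equates the results.
      extensional : ∀ {κ κ′} → (∀ ρ → κ ρ ≡ κ′ ρ) → ∀ ρ → F κ ρ ≡ F κ′ ρ
      extensional κ≗κ′ ρ = ≤ₐ-antisym (monotonic (λ σ → ≤ₐ-reflexive (κ≗κ′ σ)) ρ)
                                      (monotonic (λ σ → ≤ₐ-reflexive (sym (κ≗κ′ σ))) ρ)

    open Regular

    id-regular : Regular (λ κ → κ)
    id-regular = record
      { closed      = λ _ κ-measurable → κ-measurable
      ; homogeneous = λ _ _ _ → refl
      ; monotonic   = λ κ≤κ′ → κ≤κ′
      ; upper       = λ _ _ _ → ≤ₐ-refl
      ; continuous  = λ _ _ _ → refl
      }

    bottom-regular : Regular (λ _ _ → 0ₐ)
    bottom-regular = record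
      { closed      = λ _ _ → constant-measurable 0ₐ
      ; homogeneous = λ α _ _ → cong [_] (value-injective (sym (zeroʳ (value α))))
      ; monotonic   = λ _ _ → ≤ₐ-refl
      ; upper       = λ _ _ _ → 0ₐ-minimum _
      ; continuous  = λ _ _ _ → ≤ₐ-antisym (0ₐ-minimum _) (⨆-least λ _ → ≤ₐ-refl)
      }

    ∘-regular : ∀ {F G} → Regular F → Regular G → Regular (λ κ → F (G κ))
    ∘-regular {F} {G} F-regular G-regular = record
      { closed      = λ κ κ-measurable → closed F-regular _ (closed G-regular κ κ-measurable)
      ; homogeneous = λ α κ ρ → trans
          (extensional F-regular (homogeneous G-regular α κ) ρ)
          (homogeneous F-regular α (G κ) ρ)
      ; monotonic   = λ κ≤κ′ → monotonic F-regular (monotonic G-regular κ≤κ′)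
      ; upper       = λ κ κ′ ρ → ≤ₐ-trans
          (monotonic F-regular (upper G-regular κ κ′) ρ)
          (upper F-regular (G κ) (G κ′) ρ)
      ; continuous  = λ κ κ-ascending ρ → trans
          (extensional F-regular (continuous G-regular κ κ-ascending) ρ)
          -- Monotonicity of `G` keeps this sequence ascending, as continuity of `F` requires.
          (continuous F-regular (λ n → G (κ n)) (λ n → monotonic G-regular (κ-ascending n)) ρ)
      }

    assignment-regular : ∀ x e → Regular (wp ⋆ (x ≔ e))
    assignment-regular x e = record
      { closed      = λ κ κ-measurable W W-borel →
          update-measurable x e (κ ⊢ W) (κ-measurable W W-borel)
      ; homogeneous = λ _ _ _ → refl
      ; monotonic   = λ κ≤κ′ ρ → κ≤κ′ _
      ; upper       = λ _ _ _ → ≤ₐ-refl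
      ; continuous  = λ _ _ _ → refl
      }

    branch-regular : ∀ t {F₁ F₀} → Regular F₁ → Regular F₀ →
                     Regular (λ κ → branch ⋆ t (F₁ κ) (F₀ κ))
    branch-regular t {F₁} {F₀} F₁-regular F₀-regular = record
      { closed      = λ κ κ-measurable →
          branch-measurable t (closed F₁-regular κ κ-measurable) (closed F₀-regular κ κ-measurable)
      ; homogeneous = λ α κ ρ → trans
          (⨆-cong λ { (true  , _) → homogeneous F₁-regular α κ ρ
                    ; (false , _) → homogeneous F₀-regular α κ ρ })
          (*ₐ-⨆ α (choice κ ρ))
      ; monotonic   = λ κ≤κ′ ρ →
          ⨆-mono λ { (true  , _) → monotonic F₁-regular κ≤κ′ ρ
                   ; (false , _) → monotonic F₀-regular κ≤κ′ ρ }
      ; upper       = λ κ κ′ ρ → ≤ₐ-trans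
          (⨆-mono λ { (true  , _) → upper F₁-regular κ κ′ ρ
                    ; (false , _) → upper F₀-regular κ κ′ ρ })
          (⨆-subadditive (choice κ ρ) (choice κ′ ρ))
      ; continuous  = λ κ κ-ascending ρ → trans
          (⨆-cong λ { (true  , _) → continuous F₁-regular κ κ-ascending ρ
                    ; (false , _) → continuous F₀-regular κ κ-ascending ρ })
          -- The supremum over outcomes is exchanged with the one over the sequence.
          (⨆-swap λ i n → choice (κ n) ρ i)
      }
      where
      choice : ∀ κ ρ → ∃ (⟦ t ⟧ᵗ ⋆ ρ) → Ans
      choice κ ρ (b , _) = if b then F₁ κ ρ else F₀ κ ρ

    ⨆-regular : ∀ {F : ℕ → Cont ⋆ → Cont ⋆} → (∀ n → Regular (F n)) →
                Regular (λ κ ρ → ⨆ (λ n → F n κ ρ))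
    ⨆-regular {F} F-regular = record
      { closed      = λ κ κ-measurable → ⨆-measurable λ n → closed (F-regular n) κ κ-measurable
      ; homogeneous = λ α κ ρ → trans
          (⨆-cong λ n → homogeneous (F-regular n) α κ ρ) (*ₐ-⨆ α (λ n → F n κ ρ))
      ; monotonic   = λ κ≤κ′ ρ → ⨆-mono λ n → monotonic (F-regular n) κ≤κ′ ρ
      ; upper       = λ κ κ′ ρ → ≤ₐ-trans
          (⨆-mono λ n → upper (F-regular n) κ κ′ ρ)
          (⨆-subadditive (λ n → F n κ ρ) (λ n → F n κ′ ρ))
      ; continuous  = λ κ κ-ascending ρ → trans
          (⨆-cong λ n → continuous (F-regular n) κ κ-ascending ρ)
          (⨆-swap λ n m → F n (κ m) ρ)
      }

    wp-regular : ∀ P → Regular (wp ⋆ P)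
    wp-regular skip           = id-regular
    wp-regular (x ≔ e)        = assignment-regular x e
    wp-regular (cond t P₁ P₀) = branch-regular t (wp-regular P₁) (wp-regular P₀)
    wp-regular (P ⨾ Q)        = ∘-regular (wp-regular P) (wp-regular Q)
    wp-regular (while t P)    = ⨆-regular approximant-regular
      where
      approximant-regular : ∀ n → Regular (fold (λ _ _ → 0ₐ) (H ⋆ t (wp ⋆ P)) n)
      approximant-regular zero    = bottom-regular
      approximant-regular (suc n) =
        -- One more iteration runs the body and then the previous approximant; leaving the loop is
        -- the identity on continuations.
        branch-regular t (∘-regular (wp-regular P) (approximant-regular n)) id-regular

proposition5 : (em : ExcludedMiddle 0ℓ) (𝓡 : Reals) →
    let open Values em 𝓡 in
    (𝓕 : FloatingPoint) (𝒱 : Set) → (𝒱 ↣ ℕ) →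
    let open Syntax 𝒱
        open Semantics em 𝓡 𝓕 𝒱 in
    (⋆ : Mode) (P : Instr) →
      IsParametricPrevision (openEnv ⋆) (wp ⋆ P) ×
      IsUpper (openEnv ⋆) (wp ⋆ P) ×
      IsωContinuous (openEnv ⋆) (wp ⋆ P)
proposition5 em 𝓡 𝓕 𝒱 𝒱-countable ⋆ P =
  record
    { closed      = closed
    ; homogeneous = λ α κ _ → homogeneous α κ
    ; monotonic   = λ _ _ _ _ → monotonic
    } ,
  (λ κ κ′ _ _ → upper κ κ′) ,
  (λ κ _ → continuous κ)
  where
  open Programs em 𝓡 𝓕 𝒱 𝒱-countable
  open Regular (wp-regular ⋆ P)
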